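{- Let $G$ be a profinite group, let $(A,B,C)$ be a Tate product over $G$, and let $r,s\ge 0$ be integers. Then for every $\alpha''\in H^r(G,A'')$ and $\beta''\in H^s(G,B'')$ one has $$\alpha''\cup_{\mathrm{aug}}\beta''=(-1)^{rs}\,\beta''\cup_{\mathrm{aug}}\alpha''\quad\text{in } H^{r+s+1}(G,C),$$ where the product on the left is the augmented cup product of $(A,B,C)$ and the product on the right is the augmented cup product of the flipped Tate product $(B,A,C)$.
   Context: For a discrete $G$-module $A$, $C^r(G,A)$ is the group of continuous maps $G^r\to A$, with coboundary $d_rf(x_1,\ldots,x_{r+1})=x_1 f(x_2,\ldots,x_{r+1})+\sum_{i=1}^r(-1)^i f(x_1,\ldots,x_ix_{i+1},\ldots,x_{r+1})+(-1)^{r+1}f(x_1,\ldots,x_r)$; $Z^r=\ker d_r$, $B^r=\operatorname{im} d_{r-1}$, $H^r=Z^r/B^r$. A map $A\times B\to C$, $(a,b)\mapsto a\times b$, of discrete $G$-modules is $G$-bilinear if it is bilinear and $g(a\times b)=ga\times gb$. It induces the cup product $\cup:C^r(G,A)\times C^s(G,B)\to C^{r+s}(G,C)$, $(f\cup g)(x_1,\ldots,x_{r+s})=f(x_1,\ldots,x_r)\times x_1\cdots x_r\, g(x_{r+1},\ldots,x_{r+s})$. A Tate product $(A,B,C)$ over $G$ consists of two short exact sequences of discrete $G$-modules $0\to A'\xrightarrow{i}A\xrightarrow{j}A''\to0$ and $0\to B'\xrightarrow{i}B\xrightarrow{j}B''\to0$, a discrete $G$-module $C$, and two $G$-bilinear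 maps $A'\times B\to C$ and $A\times B'\to C$ that coincide on $A'\times B'$. One identifies $C^r(G,A')$ with $\ker(j_*:C^r(G,A)\to C^r(G,A''))$, and similarly for $B'$. Augmented cup product $\cup_{\mathrm{aug}}:H^r(G,A'')\times H^s(G,B'')\to H^{r+s+1}(G,C)$: given $\alpha'',\beta''$, choose $f\in C^r(G,A)$, $g\in C^s(G,B)$ with $j_*f,j_*g$ cocycles representing $\alpha'',\beta''$; then $d_rf\in C^{r+1}(G,A')$, $d_sg\in C^{s+1}(G,B')$, and $\alpha''\cup_{\mathrm{aug}}\beta''=[d_rf\cup g+(-1)^rf\cup d_sg]$ (well defined). Flipped Tate product $(B,A,C)$: the same two exact sequences in the opposite order, with bilinear maps $B'\times A\to C$, $(b',a)\mapsto a\times b'$, and $B\times A'\to C$, $(b,a')\mapsto a'\times b$. -}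

module Defs where

open import Level using (Level; 0ℓ; _⊔_) renaming (suc to lsuc)
open import Algebra.Bundles using (Group; AbelianGroup)
open import Algebra.Structures using (IsAbelianGroup)
open import Algebra.Morphism.Structures using (IsGroupHomomorphism)
import Algebra.Properties.AbelianGroup as AbelianGroupProperties
import Algebra.Properties.CommutativeMonoid.Sum as SumProperties
import Algebra.Properties.CommutativeSemigroup as CommutativeSemigroupProperties
open import Data.Fin.Base using (Fin; toℕ) renaming (zero to fzero; suc to fsuc)
import Data.Fin.Properties as Fin
open import Data.List.Base as List using (List; []; _∷_)
open import Data.List.Relation.Unary.Any as Any using (Any; here; there)
import Data.List.Relation.Unary.Any.Properties as Any
open import Data.Nat.Base using (ℕ; zero; suc) renaming (_+_ to _ℕ+_)
import Data.Nat.Properties as ℕ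
open import Data.Product.Base using (∃; _×_; _,_; proj₁; proj₂)
open import Data.Vec.Base as Vec using (Vec; []; _∷_; take; drop; init; head; tail)
open import Data.Vec.Properties using (cast-is-id)
open import Data.Vec.Relation.Binary.Pointwise.Inductive as PW using (Pointwise; []; _∷_)
open import Function.Base using (_∘_)
open import Function.Bundles using (Inverse)
open import Function.Definitions using (Injective; StrictlySurjective)
open import Relation.Binary.Bundles using (Setoid)
open import Relation.Binary.Definitions using (Decidable)
open import Relation.Binary.PropositionalEquality as ≡ using (_≡_; subst)
import Relation.Binary.Reasoning.Setoid as SetoidReasoning
open import Relation.Nullary.Decidable using (Dec; yes; no; map′)
open import Relation.Nullary.Negation using (contradiction)
open import Relation.Unary using (Pred)

------------------------------------------------------------------------
-- Profinite groups

-- A profinite group is presented as a compact Hausdorff group in which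
-- the kernels of a directed family of homomorphisms π i to finite groups
-- are a neighbourhood basis of the identity; compactness makes it the
-- inverse limit of the quotients by these kernels.  The cosets of the
-- kernels, the classes of  _≈[ i ]_ , are a basis of the topology.
record ProfiniteGroup (g : Level) : Set (lsuc g) where
  field
    group    : Group g g

  open Group group public

  field
    Index    : Set g
    Quotient : Index → Group 0ℓ 0ℓ
    finite   : ∀ i → ∃ λ n → Inverse (Group.setoid (Quotient i)) (≡.setoid (Fin n))
    π        : ∀ i → Carrier → Group.Carrier (Quotient i)
    π-isHomomorphism : ∀ i → IsGroupHomomorphism rawGroup (Group.rawGroup (Quotient i)) (π i)

  infix 4 _≈[_]_

  _≈[_]_ : Carrier → Index → Carrier → Set
  x ≈[ i ] y = Group._≈_ (Quotient i) (π i x) (π i y)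

  Open : Pred Carrier g → Set g
  Open U = ∀ x → U x → ∃ λ i → ∀ y → x ≈[ i ] y → U y

  field
    index₀    : Index
    directed  : ∀ i j → ∃ λ k → ∀ x y → x ≈[ k ] y → x ≈[ i ] y × x ≈[ j ] y
    hausdorff : ∀ x y → (∀ i → x ≈[ i ] y) → x ≈ y
    compact   : ∀ {J : Set g} (U : J → Pred Carrier g) → (∀ j → Open (U j)) →
                (∀ x → ∃ λ j → U j x) →
                ∃ λ (js : List J) → ∀ x → Any (λ j → U j x) js

  infix 4 _≋_ _≋[_]_

  _≋_ : ∀ {n} → Vec Carrier n → Vec Carrier n → Set g
  _≋_ = Pointwise _≈_

  _≋[_]_ : ∀ {n} → Vec Carrier n → Index → Vec Carrier n → Set g
  xs ≋[ i ] ys = Pointwise (λ x y → x ≈[ i ] y) xs ys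

  -- Continuity of a map from Gⁿ, with the product topology, to a
  -- discrete space.  One index serves all coordinates because the
  -- family of kernels is directed.
  Continuous : ∀ {a ℓ n} (S : Setoid a ℓ) → (Vec Carrier n → Setoid.Carrier S) → Set (g ⊔ ℓ)
  Continuous S f = ∀ xs → ∃ λ i → ∀ ys → xs ≋[ i ] ys → Setoid._≈_ S (f xs) (f ys)

  -- The product x₁⋯xₙ.
  ∏ : ∀ {n} → Vec Carrier n → Carrier
  ∏ = Vec.foldr (λ _ → Carrier) _∙_ ε

  -- (x₁,…,xₙ₊₁) ↦ (x₁,…,xᵢxᵢ₊₁,…,xₙ₊₁), where i is counted from 0.
  merge : ∀ {n} → Fin n → Vec Carrier (suc n) → Vec Carrier n
  merge fzero    (x ∷ y ∷ xs) = x ∙ y ∷ xs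
  merge (fsuc i) (x ∷ xs)     = x ∷ merge i xs

  module π i = IsGroupHomomorphism (π-isHomomorphism i)
  module Q i = Group (Quotient i)

  ≈⇒≈[] : ∀ i {x y} → x ≈ y → x ≈[ i ] y
  ≈⇒≈[] i = π.⟦⟧-cong i

  ∙-cong[] : ∀ i {x y u v} → x ≈[ i ] y → u ≈[ i ] v → x ∙ u ≈[ i ] y ∙ v
  ∙-cong[] i p q = Q.trans i (π.homo i _ _) (Q.trans i (Q.∙-cong i p q) (Q.sym i (π.homo i _ _)))

  ≋-refl : ∀ {n} {xs : Vec Carrier n} → xs ≋ xs
  ≋-refl = PW.refl refl

  ≋⇒≋[] : ∀ i {n} {xs ys : Vec Carrier n} → xs ≋ ys → xs ≋[ i ] ys
  ≋⇒≋[] i = PW.map (≈⇒≈[] i)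

  ≋[]-refl : ∀ i {n} {xs : Vec Carrier n} → xs ≋[ i ] xs
  ≋[]-refl i = PW.refl (Q.refl i)

  ≋[]-trans : ∀ i {n} {xs ys zs : Vec Carrier n} → xs ≋[ i ] ys → ys ≋[ i ] zs → xs ≋[ i ] zs
  ≋[]-trans i = PW.trans (Q.trans i)

  ≋[]-sym : ∀ i {n} {xs ys : Vec Carrier n} → xs ≋[ i ] ys → ys ≋[ i ] xs
  ≋[]-sym i = PW.sym (Q.sym i)

  ≈[]-dec : ∀ i → Decidable (_≈[ i ]_)
  ≈[]-dec i x y = map′ injective to-cong (to (π i x) Fin.≟ to (π i y))
    where
    open Inverse (proj₂ (finite i))
    injective : to (π i x) ≡ to (π i y) → x ≈[ i ] y
    injective eq = Q.trans i (Q.sym i (strictlyInverseʳ _)) (Q.trans i (from-cong eq) (strictlyInverseʳ _))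

  ≋[]-dec : ∀ i {n} (xs ys : Vec Carrier n) → Dec (xs ≋[ i ] ys)
  ≋[]-dec i = PW.decidable (≈[]-dec i)

  ∏-cong[] : ∀ i {n} {xs ys : Vec Carrier n} → xs ≋[ i ] ys → ∏ xs ≈[ i ] ∏ ys
  ∏-cong[] i []       = Q.refl i
  ∏-cong[] i (p ∷ ps) = ∙-cong[] i p (∏-cong[] i ps)

  merge-cong[] : ∀ i {n} (k : Fin n) {xs ys : Vec Carrier (suc n)} →
                 xs ≋[ i ] ys → merge k xs ≋[ i ] merge k ys
  merge-cong[] i fzero    (p ∷ q ∷ ps) = ∙-cong[] i p q ∷ ps
  merge-cong[] i (fsuc k) (p ∷ ps)     = p ∷ merge-cong[] i k ps

  init-cong[] : ∀ i {n} {xs ys : Vec Carrier (suc n)} → xs ≋[ i ] ys → init xs ≋[ i ] init ys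
  init-cong[] i (p ∷ [])     = []
  init-cong[] i (p ∷ q ∷ ps) = p ∷ init-cong[] i (q ∷ ps)

  take-cong[] : ∀ i m {n} {xs ys : Vec Carrier (m ℕ+ n)} → xs ≋[ i ] ys → take m xs ≋[ i ] take m ys
  take-cong[] i zero    ps       = []
  take-cong[] i (suc m) (p ∷ ps) = p ∷ take-cong[] i m ps

  drop-cong[] : ∀ i m {n} {xs ys : Vec Carrier (m ℕ+ n)} → xs ≋[ i ] ys → drop m xs ≋[ i ] drop m ys
  drop-cong[] i zero    ps       = ps
  drop-cong[] i (suc m) (p ∷ ps) = drop-cong[] i m ps

  directed≋ : ∀ i j → ∃ λ k → ∀ {n} {xs ys : Vec Carrier n} →
              xs ≋[ k ] ys → xs ≋[ i ] ys × xs ≋[ j ] ys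
  directed≋ i j with directed i j
  ... | k , h = k , λ ps → PW.map (proj₁ ∘ h _ _) ps , PW.map (proj₂ ∘ h _ _) ps

  module _ {a} {A : Set a} (m : A → Index) where

    join : List A → Index
    join []       = index₀
    join (x ∷ xs) = proj₁ (directed (m x) (join xs))

    join-≈[] : ∀ {p} {P : A → Set p} xs → Any P xs →
               Any (λ a → P a × ∀ x y → x ≈[ join xs ] y → x ≈[ m a ] y) xs
    join-≈[] (x ∷ xs) (here p)  = here (p , λ u v q → proj₁ (proj₂ (directed (m x) (join xs)) u v q))
    join-≈[] (x ∷ xs) (there p) =
      there (Any.map (λ (p , h) → p , λ u v q → h u v (proj₂ (proj₂ (directed (m x) (join xs)) u v q)))
                     (join-≈[] xs p))

  -- Compactness of Gⁿ, for covers by basic open sets.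
  cover : ∀ {n} (m : Vec Carrier n → Index) →
          ∃ λ (L : List (Vec Carrier n)) → ∀ ys → Any (λ xs → xs ≋[ m xs ] ys) L
  cover {zero}  m = [] ∷ [] , λ { [] → here [] }
  cover {suc n} m = L , covers
    where
    slice : ∀ x → ∃ λ (L : List (Vec Carrier n)) → ∀ ys → Any (λ xs → xs ≋[ m (x ∷ xs) ] ys) L
    slice x = cover (λ xs → m (x ∷ xs))

    k : Carrier → Index
    k x = join (λ xs → m (x ∷ xs)) (proj₁ (slice x))

    U : Carrier → Pred Carrier g
    U x y = Level.Lift g (x ≈[ k x ] y)

    centres : ∃ λ (X : List Carrier) → ∀ y → Any (λ x → U x y) X
    centres = compact U
      (λ x y (Level.lift p) → k x , λ z q → Level.lift (Q.trans (k x) p q))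
      (λ x → x , Level.lift (Q.refl (k x)))

    L : List (Vec Carrier (suc n))
    L = List.concatMap (λ x → List.map (x ∷_) (proj₁ (slice x))) (proj₁ centres)

    covers : ∀ ys → Any (λ xs → xs ≋[ m xs ] ys) L
    covers (y ∷ ys) = Any.concatMap⁺ _ (Any.map
      (λ {x} (Level.lift p) → Any.map⁺ (Any.map
        (λ (q , h) → h x y p ∷ q)
        (join-≈[] (λ xs → m (x ∷ xs)) (proj₁ (slice x)) (proj₂ (slice x) ys))))
      (proj₂ centres y))

  module _ {a ℓ n} (S : Setoid a ℓ) (f : Vec Carrier n → Setoid.Carrier S) (f-cont : Continuous S f) where
    private module S = Setoid S

    continuous⇒cong : ∀ {xs ys} → xs ≋ ys → f xs S.≈ f ys
    continuous⇒cong {xs} ps = proj₂ (f-cont xs) _ (≋⇒≋[] (proj₁ (f-cont xs)) ps)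

    private
      m = proj₁ ∘ f-cont
      L = proj₁ (cover m)

    modulus : Index
    modulus = join m L

    uniform : ∀ {xs ys} → xs ≋[ modulus ] ys → f xs S.≈ f ys
    uniform {xs} {ys} ps with Any.satisfied (join-≈[] m L (proj₂ (cover m) xs))
    ... | zs , q , h =
      S.trans (S.sym (proj₂ (f-cont zs) xs q))
              (proj₂ (f-cont zs) ys (≋[]-trans (m zs) q (PW.map (h _ _) ps)))

  -- A choice of representatives of the classes of  _≋[ k ]_ .
  module _ (k : Index) where

    first : ∀ {n} → List (Vec Carrier n) → Vec Carrier n → Vec Carrier n
    first []       ys = ys
    first (x ∷ xs) ys with ≋[]-dec k x ys
    ... | yes _ = x
    ... | no  _ = first xs ys

    first-≋ : ∀ {n} (xs : List (Vec Carrier n)) ys → first xs ys ≋[ k ] ys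
    first-≋ []       ys = ≋[]-refl k
    first-≋ (x ∷ xs) ys with ≋[]-dec k x ys
    ... | yes p = p
    ... | no  _ = first-≋ xs ys

    first-unique : ∀ {n} (xs : List (Vec Carrier n)) {ys zs} → Any (λ x → x ≋[ k ] ys) xs →
                   ys ≋[ k ] zs → first xs ys ≡ first xs zs
    first-unique (x ∷ xs) {ys} {zs} p q with ≋[]-dec k x ys | ≋[]-dec k x zs
    ... | yes _ | yes _ = ≡.refl
    ... | yes r | no ¬r = contradiction (≋[]-trans k r q) ¬r
    ... | no ¬r | yes r = contradiction (≋[]-trans k r (≋[]-sym k q)) ¬r
    first-unique (x ∷ xs) (here p)  q | no ¬r | no _ = contradiction p ¬r
    first-unique (x ∷ xs) (there p) q | no _  | no _ = first-unique xs p q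

    rep : ∀ {n} → Vec Carrier n → Vec Carrier n
    rep = first (proj₁ (cover (λ _ → k)))

    rep-≋ : ∀ {n} (ys : Vec Carrier n) → rep ys ≋[ k ] ys
    rep-≋ = first-≋ (proj₁ (cover (λ _ → k)))

    rep-unique : ∀ {n} {ys zs : Vec Carrier n} → ys ≋[ k ] zs → rep ys ≡ rep zs
    rep-unique {ys = ys} = first-unique (proj₁ (cover (λ _ → k))) (proj₂ (cover (λ _ → k)) ys)

-- (-1)ⁿ a in an abelian group.
[-1]^ : ∀ {c ℓ} (M : AbelianGroup c ℓ) → ℕ → AbelianGroup.Carrier M → AbelianGroup.Carrier M
[-1]^ M zero    a = a
[-1]^ M (suc n) a = AbelianGroup._⁻¹ M ([-1]^ M n a)

------------------------------------------------------------------------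
-- Discrete modules

record DiscreteModule {g} (G : ProfiniteGroup g) (c ℓ : Level) : Set (g ⊔ lsuc (c ⊔ ℓ)) where
  private module G = ProfiniteGroup G
  field
    abelianGroup : AbelianGroup c ℓ

  open AbelianGroup abelianGroup public
    renaming
    ( _∙_ to infixl 6 _+_ ; ε to 0# ; _⁻¹ to infix 8 -_
    ; ∙-cong to +-cong ; ∙-congˡ to +-congˡ ; ∙-congʳ to +-congʳ
    ; ⁻¹-cong to -‿cong
    ; identityˡ to +-identityˡ ; identityʳ to +-identityʳ
    ; inverseˡ to -‿inverseˡ ; inverseʳ to -‿inverseʳ
    ; assoc to +-assoc ; comm to +-comm
    )

  infixr 7 _·_
  field
    _·_          : G.Carrier → Carrier → Carrier
    ·-congˡ      : ∀ x {a b} → a ≈ b → x · a ≈ x · b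
    ·-identity   : ∀ a → G.ε · a ≈ a
    ·-assoc      : ∀ x y a → (x G.∙ y) · a ≈ x · y · a
    ·-distrib-+  : ∀ x a b → x · (a + b) ≈ x · a + x · b
    ·-continuous : ∀ x a → ∃ λ i → ∀ y → x G.≈[ i ] y → x · a ≈ y · a

  ·-congʳ : ∀ {x y} a → x G.≈ y → x · a ≈ y · a
  ·-congʳ {x} {y} a p = proj₂ (·-continuous x a) y (G.≈⇒≈[] (proj₁ (·-continuous x a)) p)

  open AbelianGroupProperties abelianGroup public
    using ()
    renaming
    ( ⁻¹-∙-comm to -‿+-comm ; ⁻¹-involutive to -‿involutive ; ε⁻¹≈ε to -0#≈0#
    ; ∙-cancelˡ to +-cancelˡ ; inverseˡ-unique to -‿uniqueˡ
    ; \\-leftDividesˡ to x+[-x+y]≈y ; x∙y⁻¹≈ε⇒x≈y to x-y≈0⇒x≈y ; x≈y⇒x∙y⁻¹≈ε to x≈y⇒x-y≈0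
    )
  open CommutativeSemigroupProperties commutativeSemigroup public
    using (interchange; x∙yz≈y∙xz)
  open SumProperties commutativeMonoid public
    using (sum; sum-cong-≋; ∑-distrib-+; sum-replicate-zero)

module _ {c₁ ℓ₁ c₂ ℓ₂} (M : AbelianGroup c₁ ℓ₁) (N : AbelianGroup c₂ ℓ₂) where
  private
    module M = AbelianGroup M
    module N = AbelianGroup N
    open AbelianGroupProperties N

  -- A map of abelian groups respecting sums respects 0 and negatives.
  record Additive (φ : M.Carrier → N.Carrier) : Set (c₁ ⊔ ℓ₁ ⊔ ℓ₂) where
    field
      φ-cong : ∀ {x y} → x M.≈ y → φ x N.≈ φ y
      φ-+    : ∀ x y → φ (x M.∙ y) N.≈ φ x N.∙ φ y

    φ-0 : φ M.ε N.≈ N.ε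
    φ-0 = ∙-cancelˡ (φ M.ε) _ _
      (N.trans (N.sym (φ-+ _ _)) (N.trans (φ-cong (M.identityˡ _)) (N.sym (N.identityʳ _))))

    φ-‿ : ∀ x → φ (x M.⁻¹) N.≈ (φ x) N.⁻¹
    φ-‿ x = inverseˡ-unique _ _
      (N.trans (N.sym (φ-+ _ _)) (N.trans (φ-cong (M.inverseˡ x)) φ-0))

    φ-[-1]^ : ∀ n x → φ ([-1]^ M n x) N.≈ [-1]^ N n (φ x)
    φ-[-1]^ zero    x = N.refl
    φ-[-1]^ (suc n) x = N.trans (φ-‿ _) (N.⁻¹-cong (φ-[-1]^ n x))

module _ {c ℓ} (M : AbelianGroup c ℓ) where
  private
    module M = AbelianGroup M
    open AbelianGroupProperties M

  ⁻¹-additive : Additive M M M._⁻¹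
  ⁻¹-additive = record { φ-cong = M.⁻¹-cong ; φ-+ = λ x y → M.sym (⁻¹-∙-comm x y) }

  [-1]^-additive : ∀ n → Additive M M ([-1]^ M n)
  [-1]^-additive zero    = record { φ-cong = λ p → p ; φ-+ = λ _ _ → M.refl }
  [-1]^-additive (suc n) = record
    { φ-cong = λ p → M.⁻¹-cong (R.φ-cong p)
    ; φ-+    = λ x y → M.trans (M.⁻¹-cong (R.φ-+ x y)) (M.sym (⁻¹-∙-comm _ _)) }
    where module R = Additive ([-1]^-additive n)

  [-1]^-invol : ∀ n x → [-1]^ M n ([-1]^ M n x) M.≈ x
  [-1]^-invol zero    x = M.refl
  [-1]^-invol (suc n) x =
    M.trans (M.⁻¹-cong (Additive.φ-‿ ([-1]^-additive n) _))
            (M.trans (⁻¹-involutive _) ([-1]^-invol n x))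

module _ {g} {G : ProfiniteGroup g} where
  private module G = ProfiniteGroup G

  record ModuleHom {c₁ ℓ₁ c₂ ℓ₂} (A : DiscreteModule G c₁ ℓ₁) (B : DiscreteModule G c₂ ℓ₂) :
                   Set (g ⊔ c₁ ⊔ ℓ₁ ⊔ c₂ ⊔ ℓ₂) where
    private
      module A = DiscreteModule A
      module B = DiscreteModule B
    field
      ⟦_⟧            : A.Carrier → B.Carrier
      isHomomorphism : IsGroupHomomorphism A.rawGroup B.rawGroup ⟦_⟧
      equivariant    : ∀ x a → ⟦ x A.· a ⟧ B.≈ x B.· ⟦ a ⟧

    open IsGroupHomomorphism isHomomorphism public
      using (⟦⟧-cong; homo; ε-homo; ⁻¹-homo)

    additive : Additive A.abelianGroup B.abelianGroup ⟦_⟧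
    additive = record { φ-cong = ⟦⟧-cong ; φ-+ = homo }

  -- 0 → A′ → A → A″ → 0
  record ShortExact {c ℓ} (A′ A A″ : DiscreteModule G c ℓ) : Set (g ⊔ c ⊔ ℓ) where
    private
      module A′ = DiscreteModule A′
      module A  = DiscreteModule A
      module A″ = DiscreteModule A″
    field
      i : ModuleHom A′ A
      j : ModuleHom A A″

    open ModuleHom i public using () renaming (⟦_⟧ to i⟦_⟧)
    open ModuleHom j public using () renaming (⟦_⟧ to j⟦_⟧)

    field
      i-injective  : Injective A′._≈_ A._≈_ i⟦_⟧
      j-surjective : StrictlySurjective A″._≈_ j⟦_⟧
      j∘i≈0        : ∀ a′ → j⟦ i⟦ a′ ⟧ ⟧ A″.≈ A″.0#
      ker-j⊆im-i   : ∀ a → j⟦ a ⟧ A″.≈ A″.0# → ∃ λ a′ → i⟦ a′ ⟧ A.≈ a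

  -- A G-bilinear map A × B → C.
  record Bilinear {c₁ ℓ₁ c₂ ℓ₂ c₃ ℓ₃} (A : DiscreteModule G c₁ ℓ₁)
                  (B : DiscreteModule G c₂ ℓ₂) (C : DiscreteModule G c₃ ℓ₃) :
                  Set (g ⊔ c₁ ⊔ ℓ₁ ⊔ c₂ ⊔ ℓ₂ ⊔ c₃ ⊔ ℓ₃) where
    private
      module A = DiscreteModule A
      module B = DiscreteModule B
      module C = DiscreteModule C
    infixl 7 _⊗_
    field
      _⊗_         : A.Carrier → B.Carrier → C.Carrier
      ⊗-cong      : ∀ {a a₁ b b₁} → a A.≈ a₁ → b B.≈ b₁ → a ⊗ b C.≈ a₁ ⊗ b₁
      ⊗-+ˡ        : ∀ a a₁ b → (a A.+ a₁) ⊗ b C.≈ a ⊗ b C.+ a₁ ⊗ b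
      ⊗-+ʳ        : ∀ a b b₁ → a ⊗ (b B.+ b₁) C.≈ a ⊗ b C.+ a ⊗ b₁
      equivariant : ∀ x a b → x C.· (a ⊗ b) C.≈ (x A.· a) ⊗ (x B.· b)

    additiveˡ : ∀ b → Additive A.abelianGroup C.abelianGroup (_⊗ b)
    additiveˡ b = record { φ-cong = λ p → ⊗-cong p B.refl ; φ-+ = λ a a₁ → ⊗-+ˡ a a₁ b }

    additiveʳ : ∀ a → Additive B.abelianGroup C.abelianGroup (a ⊗_)
    additiveʳ a = record { φ-cong = ⊗-cong A.refl ; φ-+ = ⊗-+ʳ a }

------------------------------------------------------------------------
-- Cochains and the coboundary

  record Cochain {c ℓ} (A : DiscreteModule G c ℓ) (r : ℕ) : Set (g ⊔ c ⊔ ℓ) where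
    constructor mkCochain
    field
      fun        : Vec G.Carrier r → DiscreteModule.Carrier A
      continuous : G.Continuous (DiscreteModule.setoid A) fun

    fun-cong : ∀ {xs ys} → xs G.≋ ys → DiscreteModule._≈_ A (fun xs) (fun ys)
    fun-cong = G.continuous⇒cong (DiscreteModule.setoid A) fun continuous

  open Cochain

  -- Closure properties of continuity.
  module _ {a ℓ} (S : Setoid a ℓ) where
    open Setoid S

    const-continuous : ∀ {n} a → G.Continuous {n = n} S (λ _ → a)
    const-continuous a xs = G.index₀ , λ _ _ → refl

    pullback-continuous : ∀ {m n} {f : Vec G.Carrier n → Carrier} (φ : Vec G.Carrier m → Vec G.Carrier n) →
                          (∀ i {xs ys} → xs G.≋[ i ] ys → φ xs G.≋[ i ] φ ys) →
                          G.Continuous S f → G.Continuous S (f ∘ φ)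
    pullback-continuous φ φ-cong f-cont xs with f-cont (φ xs)
    ... | i , h = i , λ ys p → h (φ ys) (φ-cong i p)

  module _ {a ℓ a₁ ℓ₁} (S : Setoid a ℓ) (T : Setoid a₁ ℓ₁) where
    private
      module S = Setoid S
      module T = Setoid T

    map-continuous : ∀ {n} {f : Vec G.Carrier n → S.Carrier} (φ : S.Carrier → T.Carrier) →
                     (∀ {x y} → x S.≈ y → φ x T.≈ φ y) →
                     G.Continuous S f → G.Continuous T (φ ∘ f)
    map-continuous φ φ-cong f-cont xs with f-cont xs
    ... | i , h = i , λ ys p → φ-cong (h ys p)

  module _ {a ℓ a₁ ℓ₁ a₂ ℓ₂} (S : Setoid a ℓ) (T : Setoid a₁ ℓ₁) (U : Setoid a₂ ℓ₂) where
    private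
      module S = Setoid S
      module T = Setoid T
      module U = Setoid U

    map₂-continuous : ∀ {n} {f : Vec G.Carrier n → S.Carrier} {h : Vec G.Carrier n → T.Carrier}
                      (φ : S.Carrier → T.Carrier → U.Carrier) →
                      (∀ {x y u v} → x S.≈ y → u T.≈ v → φ x u U.≈ φ y v) →
                      G.Continuous S f → G.Continuous T h → G.Continuous U (λ xs → φ (f xs) (h xs))
    map₂-continuous φ φ-cong f-cont h-cont xs with f-cont xs | h-cont xs
    ... | i , p | j , q with G.directed≋ i j
    ... | k , w = k , λ ys e → φ-cong (p ys (proj₁ (w e))) (q ys (proj₂ (w e)))

  module _ {c ℓ} (A : DiscreteModule G c ℓ) where
    open DiscreteModule A
    open SetoidReasoning setoid

    sum-continuous : ∀ {n r} (f : Fin n → Vec G.Carrier r → Carrier) →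
                     (∀ k → G.Continuous setoid (f k)) →
                     G.Continuous setoid (λ xs → sum (λ k → f k xs))
    sum-continuous {zero}  f f-cont = const-continuous setoid 0#
    sum-continuous {suc n} f f-cont = map₂-continuous setoid setoid setoid _+_ +-cong
      (f-cont fzero) (sum-continuous (f ∘ fsuc) (f-cont ∘ fsuc))

    ·-cochain-continuous : ∀ {r} (p : Vec G.Carrier r → G.Carrier) (f : Vec G.Carrier r → Carrier) →
                           (∀ i {xs ys} → xs G.≋[ i ] ys → p xs G.≈[ i ] p ys) →
                           G.Continuous setoid f → G.Continuous setoid (λ xs → p xs · f xs)
    ·-cochain-continuous p f p-cong f-cont xs with f-cont xs | ·-continuous (p xs) (f xs)
    ... | i , h | j , q with G.directed≋ i j
    ... | k , w = k , λ ys e →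
      trans (q (p ys) (p-cong j (proj₂ (w e)))) (·-congˡ (p ys) (h ys (proj₁ (w e))))

    -- The summand k is the term i = k + 1 of the usual formula.
    d-fun : ∀ r → (Vec G.Carrier r → Carrier) → Vec G.Carrier (suc r) → Carrier
    d-fun r f xs =
        head xs · f (tail xs)
      + sum (λ (k : Fin r) → [-1]^ abelianGroup (suc (toℕ k)) (f (G.merge k xs)))
      + [-1]^ abelianGroup (suc r) (f (init xs))

    abstract
      d-continuous : ∀ r f → G.Continuous setoid f → G.Continuous setoid (d-fun r f)
      d-continuous r f f-cont =
        map₂-continuous setoid setoid setoid _+_ +-cong
          (map₂-continuous setoid setoid setoid _+_ +-cong
            (·-cochain-continuous head _ (λ { i (p ∷ _) → p })
              (pullback-continuous setoid tail (λ { i (_ ∷ ps) → ps }) f-cont))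
            (sum-continuous _ (λ k → signed (suc (toℕ k)) _
              (pullback-continuous setoid (G.merge k) (λ i → G.merge-cong[] i k) f-cont))))
          (signed (suc r) _ (pullback-continuous setoid init (λ i → G.init-cong[] i) f-cont))
        where
        signed : ∀ {m} n (f : Vec G.Carrier m → Carrier) → G.Continuous setoid f →
                 G.Continuous setoid (λ xs → [-1]^ abelianGroup n (f xs))
        signed n f = map-continuous setoid setoid ([-1]^ abelianGroup n)
                       (Additive.φ-cong ([-1]^-additive abelianGroup n))

  d : ∀ {c ℓ} {A : DiscreteModule G c ℓ} {r} → Cochain A r → Cochain A (suc r)
  d {A = A} {r} f = mkCochain (d-fun A r (fun f)) (d-continuous A r (fun f) (continuous f))

  infix 4 _≈ᶜ_
  record _≈ᶜ_ {c ℓ} {A : DiscreteModule G c ℓ} {r} (f h : Cochain A r) : Set (g ⊔ ℓ) where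
    constructor pointwise
    field
      at : ∀ xs → DiscreteModule._≈_ A (fun f xs) (fun h xs)

  open _≈ᶜ_

  module _ {c ℓ} {A : DiscreteModule G c ℓ} {r : ℕ} where
    private module A = DiscreteModule A

    abstract
      +-continuous : ∀ (f h : Cochain A r) → G.Continuous A.setoid (λ xs → fun f xs A.+ fun h xs)
      +-continuous f h = map₂-continuous A.setoid A.setoid A.setoid A._+_ A.+-cong (continuous f) (continuous h)

      -‿continuous : ∀ (f : Cochain A r) → G.Continuous A.setoid (λ xs → A.- fun f xs)
      -‿continuous f = map-continuous A.setoid A.setoid A.-_ A.-‿cong (continuous f)

      0-continuous : G.Continuous {n = r} A.setoid (λ _ → A.0#)
      0-continuous = const-continuous A.setoid A.0#

    infixl 6 _+ᶜ_
    infix  8 -ᶜ_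

    _+ᶜ_ : Cochain A r → Cochain A r → Cochain A r
    f +ᶜ h = mkCochain (λ xs → fun f xs A.+ fun h xs) (+-continuous f h)

    -ᶜ_ : Cochain A r → Cochain A r
    -ᶜ f = mkCochain (λ xs → A.- fun f xs) (-‿continuous f)

    0ᶜ : Cochain A r
    0ᶜ = mkCochain (λ _ → A.0#) 0-continuous

    abstract
      +ᶜ-isAbelianGroup : IsAbelianGroup (_≈ᶜ_ {A = A} {r}) _+ᶜ_ 0ᶜ -ᶜ_
      +ᶜ-isAbelianGroup = record
        { isGroup = record
          { isMonoid = record
            { isSemigroup = record
              { isMagma = record
                { isEquivalence = record
                  { refl  = pointwise (λ _ → A.refl)
                  ; sym   = λ p → pointwise (λ xs → A.sym (at p xs))
                  ; trans = λ p q → pointwise (λ xs → A.trans (at p xs) (at q xs)) }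
                ; ∙-cong = λ p q → pointwise (λ xs → A.+-cong (at p xs) (at q xs)) }
              ; assoc = λ f h k → pointwise (λ xs → A.+-assoc _ _ _) }
            ; identity = (λ f → pointwise (λ xs → A.+-identityˡ _)) , (λ f → pointwise (λ xs → A.+-identityʳ _)) }
          ; inverse = (λ f → pointwise (λ xs → A.-‿inverseˡ _)) , (λ f → pointwise (λ xs → A.-‿inverseʳ _))
          ; ⁻¹-cong = λ p → pointwise (λ xs → A.-‿cong (at p xs)) }
        ; comm = λ f h → pointwise (λ xs → A.+-comm _ _) }

  -- The group C^r(G,A).
  C^ : ∀ {c ℓ} → ℕ → DiscreteModule G c ℓ → AbelianGroup (g ⊔ c ⊔ ℓ) (g ⊔ ℓ)
  C^ r A = record { isAbelianGroup = +ᶜ-isAbelianGroup {A = A} {r} }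

  -- d f (x ∷ xs) = x · f xs + T f (x ∷ xs), where T f is given by recursion.
  module _ {c ℓ} (A : DiscreteModule G c ℓ) where
    open DiscreteModule A
    open SetoidReasoning setoid
    private
      |G| = G.Carrier

    T : ∀ r → (Vec |G| r → Carrier) → Vec |G| (suc r) → Carrier
    T zero    f (x ∷ [])     = - f []
    T (suc r) f (x ∷ y ∷ xs) = - f (x G.∙ y ∷ xs) + - T r (λ zs → f (x ∷ zs)) (y ∷ xs)

    sum-neg : ∀ n (t : Fin n → Carrier) → sum (λ k → - t k) ≈ - sum t
    sum-neg zero    t = sym -0#≈0#
    sum-neg (suc n) t = trans (+-congˡ (sum-neg n (t ∘ fsuc))) (-‿+-comm _ _)

    d-inner≈T : ∀ r (f : Vec |G| r → Carrier) xs →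
                sum (λ (k : Fin r) → [-1]^ abelianGroup (suc (toℕ k)) (f (G.merge k xs)))
                  + [-1]^ abelianGroup (suc r) (f (init xs))
                ≈ T r f xs
    d-inner≈T zero    f (x ∷ [])     = +-identityˡ _
    d-inner≈T (suc r) f (x ∷ y ∷ xs) = begin
      (- f (x G.∙ y ∷ xs) + sum (λ k → - t k)) + - e  ≈⟨ +-assoc _ _ _ ⟩
      - f (x G.∙ y ∷ xs) + (sum (λ k → - t k) + - e)  ≈⟨ +-congˡ (+-congʳ (sum-neg r t)) ⟩
      - f (x G.∙ y ∷ xs) + (- sum t + - e)            ≈⟨ +-congˡ (-‿+-comm _ _) ⟩
      - f (x G.∙ y ∷ xs) + - (sum t + e)              ≈⟨ +-congˡ (-‿cong (d-inner≈T r (λ zs → f (x ∷ zs)) (y ∷ xs))) ⟩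
      T (suc r) f (x ∷ y ∷ xs)                        ∎
      where
      t : Fin r → Carrier
      t k = [-1]^ abelianGroup (suc (toℕ k)) (f (x ∷ G.merge k (y ∷ xs)))
      e : Carrier
      e = [-1]^ abelianGroup (suc r) (f (x ∷ init (y ∷ xs)))

    d≈T : ∀ r (f : Vec |G| r → Carrier) x xs → d-fun A r f (x ∷ xs) ≈ x · f xs + T r f (x ∷ xs)
    d≈T r f x xs = trans (+-assoc _ _ _) (+-congˡ (d-inner≈T r f (x ∷ xs)))

    T-cong : ∀ r (f h : Vec |G| r → Carrier) → (∀ xs → f xs ≈ h xs) → ∀ xs → T r f xs ≈ T r h xs
    T-cong zero    f h p (x ∷ [])     = -‿cong (p [])
    T-cong (suc r) f h p (x ∷ y ∷ xs) = +-cong (-‿cong (p _)) (-‿cong (T-cong r _ _ (λ zs → p (x ∷ zs)) (y ∷ xs)))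

    T-+ : ∀ r (f h : Vec |G| r → Carrier) xs → T r (λ zs → f zs + h zs) xs ≈ T r f xs + T r h xs
    T-+ zero    f h (x ∷ [])     = sym (-‿+-comm _ _)
    T-+ (suc r) f h (x ∷ y ∷ xs) = begin
      - (f₀ + h₀) + - T r (λ zs → f (x ∷ zs) + h (x ∷ zs)) (y ∷ xs)
        ≈⟨ +-cong (sym (-‿+-comm _ _)) (trans (-‿cong (T-+ r _ _ (y ∷ xs))) (sym (-‿+-comm _ _))) ⟩
      (- f₀ + - h₀) + (- T r (λ zs → f (x ∷ zs)) (y ∷ xs) + - T r (λ zs → h (x ∷ zs)) (y ∷ xs))
        ≈⟨ interchange _ _ _ _ ⟩
      T (suc r) f (x ∷ y ∷ xs) + T (suc r) h (x ∷ y ∷ xs) ∎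
      where
      f₀ = f (x G.∙ y ∷ xs)
      h₀ = h (x G.∙ y ∷ xs)

  module _ {c₁ ℓ₁ c₂ ℓ₂} (A : DiscreteModule G c₁ ℓ₁) (B : DiscreteModule G c₂ ℓ₂) where
    private
      module A = DiscreteModule A
      module B = DiscreteModule B

    T-map : ∀ {φ} → Additive A.abelianGroup B.abelianGroup φ →
            ∀ r (f : Vec G.Carrier r → A.Carrier) xs → T B r (φ ∘ f) xs B.≈ φ (T A r f xs)
    T-map φ zero    f (x ∷ [])     = B.sym (Additive.φ-‿ φ _)
    T-map φ (suc r) f (x ∷ y ∷ xs) = B.sym (B.trans (Additive.φ-+ φ _ _)
      (B.+-cong (Additive.φ-‿ φ _)
        (B.trans (Additive.φ-‿ φ _) (B.-‿cong (B.sym (T-map φ r (λ zs → f (x ∷ zs)) (y ∷ xs)))))))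

  module _ {c ℓ} (A : DiscreteModule G c ℓ) where
    open DiscreteModule A
    open SetoidReasoning setoid
    private
      |G| = G.Carrier

      neg : Additive abelianGroup abelianGroup (λ a → - a)
      neg = ⁻¹-additive abelianGroup

    ·-additive : ∀ x → Additive abelianGroup abelianGroup (x ·_)
    ·-additive x = record { φ-cong = ·-congˡ x ; φ-+ = ·-distrib-+ x }

    TT≈0 : ∀ r (f : Vec |G| r → Carrier) → (∀ {xs ys} → xs G.≋ ys → f xs ≈ f ys) →
           ∀ xs → T A (suc r) (T A r f) xs ≈ 0#
    TT≈0 zero f f-cong (x ∷ y ∷ []) = -‿inverseʳ _
    TT≈0 (suc r) f f-cong (x ∷ y ∷ z ∷ xs) = begin
      - (- a + - b) + - T A (suc r) (λ zs → T A (suc r) f (x ∷ zs)) (y ∷ z ∷ xs)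
        ≈⟨ +-congˡ (-‿cong (T-cong A (suc r) (λ zs → T A (suc r) f (x ∷ zs)) h (λ { (w ∷ zs) → refl }) (y ∷ z ∷ xs))) ⟩
      - (- a + - b) + - T A (suc r) h (y ∷ z ∷ xs)
        ≈⟨ +-congˡ (-‿cong T-h) ⟩
      - (- a + - b) + - (- (- a + - b))
        ≈⟨ -‿inverseʳ _ ⟩
      0# ∎
      where
      a = f ((x G.∙ y) G.∙ z ∷ xs)
      b = T A r (λ zs → f (x G.∙ y ∷ zs)) (z ∷ xs)
      h₁ h₂ h : Vec |G| (suc r) → Carrier
      h₁ ws = f (x G.∙ head ws ∷ tail ws)
      h₂ = T A r (λ zs → f (x ∷ zs))
      h ws = - h₁ ws + - h₂ ws
      T-h : T A (suc r) h (y ∷ z ∷ xs) ≈ - (- a + - b)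
      T-h = begin
        T A (suc r) h (y ∷ z ∷ xs)
          ≈⟨ T-+ A (suc r) (λ ws → - h₁ ws) (λ ws → - h₂ ws) (y ∷ z ∷ xs) ⟩
        T A (suc r) (λ ws → - h₁ ws) (y ∷ z ∷ xs) + T A (suc r) (λ ws → - h₂ ws) (y ∷ z ∷ xs)
          ≈⟨ +-cong (T-map A A neg (suc r) h₁ (y ∷ z ∷ xs)) (T-map A A neg (suc r) h₂ (y ∷ z ∷ xs)) ⟩
        - T A (suc r) h₁ (y ∷ z ∷ xs) + - T A (suc r) h₂ (y ∷ z ∷ xs)
          ≈⟨ +-cong (-‿cong (+-congʳ (-‿cong (f-cong (G.sym (G.assoc x y z) ∷ G.≋-refl)))))
                    (trans (-‿cong (TT≈0 r (λ zs → f (x ∷ zs)) (λ p → f-cong (G.refl ∷ p)) (y ∷ z ∷ xs))) -0#≈0#) ⟩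
        - (- a + - b) + 0#
          ≈⟨ +-identityʳ _ ⟩
        - (- a + - b) ∎

    dd-fun≈0 : ∀ r (f : Vec |G| r → Carrier) → (∀ {xs ys} → xs G.≋ ys → f xs ≈ f ys) →
               ∀ xs → d-fun A (suc r) (d-fun A r f) xs ≈ 0#
    dd-fun≈0 r f f-cong (x ∷ y ∷ xs) = begin
      d-fun A (suc r) (d-fun A r f) (x ∷ y ∷ xs)
        ≈⟨ d≈T A (suc r) (d-fun A r f) x (y ∷ xs) ⟩
      x · d-fun A r f (y ∷ xs) + T A (suc r) (d-fun A r f) (x ∷ y ∷ xs)
        ≈⟨ +-cong (·-congˡ x (d≈T A r f y xs))
             (T-cong A (suc r) (d-fun A r f) h (λ { (w ∷ zs) → d≈T A r f w zs }) (x ∷ y ∷ xs)) ⟩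
      x · (y · f xs + T A r f (y ∷ xs)) + T A (suc r) h (x ∷ y ∷ xs)
        ≈⟨ +-cong (·-distrib-+ x _ _) (T-+ A (suc r) (λ ws → head ws · f (tail ws)) (T A r f) (x ∷ y ∷ xs)) ⟩
      (x · y · f xs + x · T A r f (y ∷ xs))
        + (T A (suc r) (λ ws → head ws · f (tail ws)) (x ∷ y ∷ xs) + T A (suc r) (T A r f) (x ∷ y ∷ xs))
        ≈⟨ +-congˡ (+-cong (+-cong (-‿cong (·-assoc x y (f xs))) (-‿cong (T-map A A (·-additive x) r f (y ∷ xs))))
                           (TT≈0 r f f-cong (x ∷ y ∷ xs))) ⟩
      (x · y · f xs + x · T A r f (y ∷ xs))
        + ((- (x · y · f xs) + - (x · T A r f (y ∷ xs))) + 0#)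
        ≈⟨ +-congˡ (trans (+-identityʳ _) (-‿+-comm _ _)) ⟩
      (x · y · f xs + x · T A r f (y ∷ xs)) + - (x · y · f xs + x · T A r f (y ∷ xs))
        ≈⟨ -‿inverseʳ _ ⟩
      0# ∎
      where
      h : Vec |G| (suc r) → Carrier
      h ws = head ws · f (tail ws) + T A r f ws

------------------------------------------------------------------------
-- Cup products

  module _ {c₁ ℓ₁ c₂ ℓ₂ c₃ ℓ₃} {A : DiscreteModule G c₁ ℓ₁} {B : DiscreteModule G c₂ ℓ₂}
           {C : DiscreteModule G c₃ ℓ₃} (β : Bilinear A B C) where
    open Bilinear β
    private
      module A = DiscreteModule A
      module B = DiscreteModule B
      module C = DiscreteModule C
      |G| = G.Carrier

    abstract
      cup-continuous : ∀ {r s} (f : Cochain A r) (h : Cochain B s) →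
                       G.Continuous C.setoid (λ xs → fun f (take r xs) ⊗ (G.∏ (take r xs) B.· fun h (drop r xs)))
      cup-continuous {r} f h = map₂-continuous A.setoid B.setoid C.setoid _⊗_ ⊗-cong
        (pullback-continuous A.setoid (take r) (λ i → G.take-cong[] i r) (continuous f))
        (·-cochain-continuous B (G.∏ ∘ take r) _ (λ i p → G.∏-cong[] i (G.take-cong[] i r p))
          (pullback-continuous B.setoid (drop r) (λ i → G.drop-cong[] i r) (continuous h)))

    cup : ∀ {r s} → Cochain A r → Cochain B s → Cochain C (r ℕ+ s)
    cup {r} f h = mkCochain (λ xs → fun f (take r xs) ⊗ (G.∏ (take r xs) B.· fun h (drop r xs)))
                            (cup-continuous f h)

    -- The cup product by recursion, with an accumulator for x₁⋯xᵣ.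
    Cup : |G| → ∀ r {s} → (Vec |G| r → A.Carrier) → (Vec |G| s → B.Carrier) → Vec |G| (r ℕ+ s) → C.Carrier
    Cup x zero    f h xs       = f [] ⊗ (x B.· h xs)
    Cup x (suc r) f h (y ∷ xs) = Cup (x G.∙ y) r (λ zs → f (y ∷ zs)) h xs

    private
      F : ℕ → Set _
      F r = Vec |G| r → A.Carrier

    cup≈Cup : ∀ x r {s} (f : F r) (h : Vec |G| s → B.Carrier) xs →
              f (take r xs) ⊗ ((x G.∙ G.∏ (take r xs)) B.· h (drop r xs)) C.≈ Cup x r f h xs
    cup≈Cup x zero    f h xs       = ⊗-cong A.refl (B.·-congʳ _ (G.identityʳ x))
    cup≈Cup x (suc r) f h (y ∷ xs) = C.trans
      (⊗-cong A.refl (B.·-congʳ _ (G.sym (G.assoc x y _))))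
      (cup≈Cup (x G.∙ y) r (λ zs → f (y ∷ zs)) h xs)

    Cup-cong : ∀ {x y} r {s} {f f₁ : F r} {h h₁ : Vec |G| s → B.Carrier} → x G.≈ y →
               (∀ xs → f xs A.≈ f₁ xs) → (∀ xs → h xs B.≈ h₁ xs) →
               ∀ xs → Cup x r f h xs C.≈ Cup y r f₁ h₁ xs
    Cup-cong zero    e p q xs       = ⊗-cong (p []) (B.trans (B.·-congʳ _ e) (B.·-congˡ _ (q xs)))
    Cup-cong (suc r) e p q (y ∷ xs) = Cup-cong r (G.∙-cong e G.refl) (λ zs → p (y ∷ zs)) q xs

    Cup-+ˡ : ∀ x r {s} (f f₁ : F r) (h : Vec |G| s → B.Carrier) xs →
             Cup x r (λ zs → f zs A.+ f₁ zs) h xs C.≈ Cup x r f h xs C.+ Cup x r f₁ h xs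
    Cup-+ˡ x zero    f f₁ h xs       = ⊗-+ˡ _ _ _
    Cup-+ˡ x (suc r) f f₁ h (y ∷ xs) = Cup-+ˡ (x G.∙ y) r _ _ h xs

    Cup-‿ˡ : ∀ x r {s} (f : F r) (h : Vec |G| s → B.Carrier) xs →
             Cup x r (λ zs → A.- f zs) h xs C.≈ C.- Cup x r f h xs
    Cup-‿ˡ x zero    f h xs       = Additive.φ-‿ (additiveˡ _) _
    Cup-‿ˡ x (suc r) f h (y ∷ xs) = Cup-‿ˡ (x G.∙ y) r _ h xs

    Cup-· : ∀ z x r {s} (f : F r) (h : Vec |G| s → B.Carrier) xs →
            z C.· Cup x r f h xs C.≈ Cup (z G.∙ x) r (λ ys → z A.· f ys) h xs
    Cup-· z x zero    f h xs       = C.trans (equivariant _ _ _) (⊗-cong A.refl (B.sym (B.·-assoc z x _)))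
    Cup-· z x (suc r) f h (y ∷ xs) = C.trans (Cup-· z (x G.∙ y) r _ h xs)
      (Cup-cong r (G.sym (G.assoc z x y)) (λ _ → A.refl) (λ _ → B.refl) xs)

    open SetoidReasoning C.setoid

    private
      sgn : ℕ → C.Carrier → C.Carrier
      sgn = [-1]^ C.abelianGroup

    T-Cup : ∀ x r {s} (f : F r) (h : Vec |G| s → B.Carrier) xs →
            T C (r ℕ+ s) (Cup x r f h) xs C.≈
            Cup x (suc r) (T A r f) h xs C.+
              sgn r (Cup x r f (d-fun B s h) (Vec.cast (≡.sym (ℕ.+-suc r s)) xs))
    T-Cup x zero {s} f h (y ∷ xs) = begin
      T C s (λ zs → f [] ⊗ (x B.· h zs)) (y ∷ xs)
        ≈⟨ T-map B C (additiveʳ (f [])) s (λ zs → x B.· h zs) (y ∷ xs) ⟩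
      f [] ⊗ T B s (λ zs → x B.· h zs) (y ∷ xs)
        ≈⟨ ⊗-cong A.refl (T-map B B (·-additive B x) s h (y ∷ xs)) ⟩
      f [] ⊗ (x B.· T B s h (y ∷ xs))
        ≈⟨ C.x+[-x+y]≈y u _ ⟨
      u C.+ (C.- u C.+ f [] ⊗ (x B.· T B s h (y ∷ xs)))
        ≈⟨ C.x∙yz≈y∙xz _ _ _ ⟩
      C.- u C.+ (u C.+ f [] ⊗ (x B.· T B s h (y ∷ xs)))
        ≈⟨ C.+-cong (C.sym (Additive.φ-‿ (additiveˡ _) _)) step ⟩
      (A.- f []) ⊗ ((x G.∙ y) B.· h xs) C.+ f [] ⊗ (x B.· d-fun B s h (y ∷ Vec.cast _ xs)) ∎
      where
      u = f [] ⊗ ((x G.∙ y) B.· h xs)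
      step : u C.+ f [] ⊗ (x B.· T B s h (y ∷ xs)) C.≈ f [] ⊗ (x B.· d-fun B s h (y ∷ Vec.cast ≡.refl xs))
      step = begin
        u C.+ f [] ⊗ (x B.· T B s h (y ∷ xs))
          ≈⟨ C.+-congʳ (⊗-cong A.refl (B.·-assoc x y _)) ⟩
        f [] ⊗ (x B.· y B.· h xs) C.+ f [] ⊗ (x B.· T B s h (y ∷ xs))
          ≈⟨ ⊗-+ʳ _ _ _ ⟨
        f [] ⊗ (x B.· y B.· h xs B.+ x B.· T B s h (y ∷ xs))
          ≈⟨ ⊗-cong A.refl (B.·-distrib-+ x _ _) ⟨
        f [] ⊗ (x B.· (y B.· h xs B.+ T B s h (y ∷ xs)))
          ≈⟨ ⊗-cong A.refl (B.·-congˡ x (d≈T B s h y xs)) ⟨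
        f [] ⊗ (x B.· d-fun B s h (y ∷ xs))
          ≡⟨ ≡.cong (λ zs → f [] ⊗ (x B.· d-fun B s h (y ∷ zs))) (≡.sym (cast-is-id ≡.refl xs)) ⟩
        f [] ⊗ (x B.· d-fun B s h (y ∷ Vec.cast ≡.refl xs)) ∎
    T-Cup x (suc r) {s} f h (y ∷ z ∷ xs) = begin
      C.- Cup (x G.∙ (y G.∙ z)) r f₁ h xs C.+ C.- T C (r ℕ+ s) (Cup (x G.∙ y) r f₂ h) (z ∷ xs)
        ≈⟨ C.+-cong (C.-‿cong (Cup-cong r (G.sym (G.assoc x y z)) (λ _ → A.refl) (λ _ → B.refl) xs))
                    (C.-‿cong (T-Cup (x G.∙ y) r f₂ h (z ∷ xs))) ⟩
      C.- p C.+ C.- (q C.+ w)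
        ≈⟨ C.+-congˡ (C.-‿+-comm q w) ⟨
      C.- p C.+ (C.- q C.+ C.- w)
        ≈⟨ C.+-assoc _ _ _ ⟨
      (C.- p C.+ C.- q) C.+ C.- w
        ≈⟨ C.+-congʳ (C.+-cong (Cup-‿ˡ _ r f₁ h xs) (Cup-‿ˡ _ r f₃ h xs)) ⟨
      (Cup ((x G.∙ y) G.∙ z) r (λ zs → A.- f₁ zs) h xs C.+ Cup ((x G.∙ y) G.∙ z) r (λ zs → A.- f₃ zs) h xs) C.+ C.- w
        ≈⟨ C.+-congʳ (Cup-+ˡ _ r (λ zs → A.- f₁ zs) (λ zs → A.- f₃ zs) h xs) ⟨
      Cup ((x G.∙ y) G.∙ z) r (λ zs → A.- f₁ zs A.+ A.- f₃ zs) h xs C.+ C.- w ∎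
      where
      f₁ f₂ f₃ : F r
      f₁ zs = f (y G.∙ z ∷ zs)
      f₂ zs = f (y ∷ zs)
      f₃ zs = T A r f₂ (z ∷ zs)
      p = Cup ((x G.∙ y) G.∙ z) r f₁ h xs
      q = Cup ((x G.∙ y) G.∙ z) r f₃ h xs
      w = sgn r (Cup (x G.∙ y) r f₂ (d-fun B s h) (Vec.cast (≡.sym (ℕ.+-suc r s)) (z ∷ xs)))

    d-Cup : ∀ r {s} (f : F r) (h : Vec |G| s → B.Carrier) xs →
            d-fun C (r ℕ+ s) (Cup G.ε r f h) xs C.≈
            Cup G.ε (suc r) (d-fun A r f) h xs C.+
              sgn r (Cup G.ε r f (d-fun B s h) (Vec.cast (≡.sym (ℕ.+-suc r s)) xs))
    d-Cup r {s} f h (x ∷ xs) = begin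
      d-fun C (r ℕ+ s) (Cup G.ε r f h) (x ∷ xs)
        ≈⟨ d≈T C (r ℕ+ s) (Cup G.ε r f h) x xs ⟩
      x C.· Cup G.ε r f h xs C.+ T C (r ℕ+ s) (Cup G.ε r f h) (x ∷ xs)
        ≈⟨ C.+-cong
             (C.trans (Cup-· x G.ε r f h xs)
               (Cup-cong r (G.trans (G.identityʳ x) (G.sym (G.identityˡ x))) (λ _ → A.refl) (λ _ → B.refl) xs))
             (T-Cup G.ε r f h (x ∷ xs)) ⟩
      Cup (G.ε G.∙ x) r f₁ h xs C.+ (Cup (G.ε G.∙ x) r f₂ h xs C.+ w)
        ≈⟨ C.+-assoc _ _ _ ⟨
      (Cup (G.ε G.∙ x) r f₁ h xs C.+ Cup (G.ε G.∙ x) r f₂ h xs) C.+ w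
        ≈⟨ C.+-congʳ (Cup-+ˡ _ r f₁ f₂ h xs) ⟨
      Cup (G.ε G.∙ x) r (λ zs → f₁ zs A.+ f₂ zs) h xs C.+ w
        ≈⟨ C.+-congʳ (Cup-cong r G.refl (d≈T A r f x) (λ _ → B.refl) xs) ⟨
      Cup (G.ε G.∙ x) r (λ zs → d-fun A r f (x ∷ zs)) h xs C.+ w ∎
      where
      f₁ f₂ : F r
      f₁ zs = x A.· f zs
      f₂ zs = T A r f (x ∷ zs)
      w = sgn r (Cup G.ε r f (d-fun B s h) (Vec.cast (≡.sym (ℕ.+-suc r s)) (x ∷ xs)))

    cup-fun : ∀ {r s} (f : Cochain A r) (h : Cochain B s) xs →
              fun (cup f h) xs C.≈ Cup G.ε r (fun f) (fun h) xs
    cup-fun {r} f h xs =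
      C.trans (⊗-cong A.refl (B.·-congʳ _ (G.sym (G.identityˡ _)))) (cup≈Cup G.ε r (fun f) (fun h) xs)

------------------------------------------------------------------------
-- Cohomology

  module _ {c ℓ} (A : DiscreteModule G c ℓ) where
    open DiscreteModule A

    eval-additive : ∀ {r} xs → Additive (C^ r A) abelianGroup (λ f → fun f xs)
    eval-additive xs = record { φ-cong = λ p → at p xs ; φ-+ = λ f h → refl }

    d-additive : ∀ {r} → Additive (C^ r A) (C^ (suc r) A) d
    d-additive {r} = record
      { φ-cong = λ {f} {h} p → pointwise λ { (x ∷ xs) →
          trans (d≈T A r (fun f) x xs)
            (trans (+-cong (·-congˡ x (at p xs)) (T-cong A r (fun f) (fun h) (at p) (x ∷ xs)))
                   (sym (d≈T A r (fun h) x xs))) }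
      ; φ-+ = λ f h → pointwise λ { (x ∷ xs) →
          trans (d≈T A r (λ ys → fun f ys + fun h ys) x xs)
            (trans (+-cong (·-distrib-+ x _ _) (T-+ A r (fun f) (fun h) (x ∷ xs)))
              (trans (interchange _ _ _ _)
                (+-cong (sym (d≈T A r (fun f) x xs)) (sym (d≈T A r (fun h) x xs))))) }
      }

    dd≈0 : ∀ {r} (f : Cochain A r) → d (d f) ≈ᶜ 0ᶜ
    dd≈0 {r} f = pointwise (dd-fun≈0 A r (fun f) (fun-cong f))

    castᶜ : ∀ {m n} → m ≡ n → Cochain A m → Cochain A n
    castᶜ = subst (Cochain A)

    castᶜ-additive : ∀ {m n} (eq : m ≡ n) → Additive (C^ m A) (C^ n A) (castᶜ eq)
    castᶜ-additive ≡.refl = record { φ-cong = λ p → p ; φ-+ = λ _ _ → pointwise λ _ → refl }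

    castᶜ-fun : ∀ {m n} (eq : m ≡ n) (f : Cochain A m) xs → fun (castᶜ eq f) xs ≡ fun f (Vec.cast (≡.sym eq) xs)
    castᶜ-fun ≡.refl f xs = ≡.cong (fun f) (≡.sym (cast-is-id ≡.refl xs))

    castᶜ-d : ∀ {m n} (eq : m ≡ n) (f : Cochain A m) → castᶜ (≡.cong suc eq) (d f) ≈ᶜ d (castᶜ eq f)
    castᶜ-d ≡.refl f = pointwise λ _ → refl

    -- B^r(G,A), with B^0(G,A) = 0.
    IsCoboundary : ∀ r → Cochain A r → Set (g ⊔ c ⊔ ℓ)
    IsCoboundary zero    f = Level.Lift (g ⊔ c ⊔ ℓ) (f ≈ᶜ 0ᶜ)
    IsCoboundary (suc r) f = ∃ λ (h : Cochain A r) → d h ≈ᶜ f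

    abstract
      coboundary-resp : ∀ r {f h} → f ≈ᶜ h → IsCoboundary r f → IsCoboundary r h
      coboundary-resp zero    p (Level.lift q) = Level.lift (AbelianGroup.trans (C^ 0 A) (AbelianGroup.sym (C^ 0 A) p) q)
      coboundary-resp (suc r) p (k , q)        = k , AbelianGroup.trans (C^ (suc r) A) q p

      coboundary-0 : ∀ r → IsCoboundary r 0ᶜ
      coboundary-0 zero    = Level.lift (AbelianGroup.refl (C^ 0 A))
      coboundary-0 (suc r) = 0ᶜ , Additive.φ-0 d-additive

      coboundary-+ : ∀ r {f h} → IsCoboundary r f → IsCoboundary r h → IsCoboundary r (f +ᶜ h)
      coboundary-+ zero (Level.lift p) (Level.lift q) = Level.lift
        (AbelianGroup.trans (C^ 0 A) (AbelianGroup.∙-cong (C^ 0 A) p q) (AbelianGroup.identityˡ (C^ 0 A) 0ᶜ))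
      coboundary-+ (suc r) (k , p) (k₁ , q) = k +ᶜ k₁ ,
        AbelianGroup.trans (C^ (suc r) A) (Additive.φ-+ d-additive k k₁) (AbelianGroup.∙-cong (C^ (suc r) A) p q)

      coboundary-neg : ∀ r {f} → IsCoboundary r f → IsCoboundary r (-ᶜ f)
      coboundary-neg zero (Level.lift p) = Level.lift
        (AbelianGroup.trans (C^ 0 A) (AbelianGroup.⁻¹-cong (C^ 0 A) p) (AbelianGroupProperties.ε⁻¹≈ε (C^ 0 A)))
      coboundary-neg (suc r) (k , p) = -ᶜ k ,
        AbelianGroup.trans (C^ (suc r) A) (Additive.φ-‿ d-additive k) (AbelianGroup.⁻¹-cong (C^ (suc r) A) p)

      coboundary⇒closed : ∀ r {f} → IsCoboundary r f → d f ≈ᶜ 0ᶜ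
      coboundary⇒closed zero (Level.lift p) =
        AbelianGroup.trans (C^ 1 A) (Additive.φ-cong d-additive p) (Additive.φ-0 d-additive)
      coboundary⇒closed (suc r) (k , p) = C.trans (Additive.φ-cong d-additive (AbelianGroup.sym (C^ (suc r) A) p)) (dd≈0 k)
        where module C = AbelianGroup (C^ (suc (suc r)) A)

      coboundary-[-1]^ : ∀ r n {f} → IsCoboundary r f → IsCoboundary r ([-1]^ (C^ r A) n f)
      coboundary-[-1]^ r zero    p = p
      coboundary-[-1]^ r (suc n) p = coboundary-neg r (coboundary-[-1]^ r n p)

      coboundary-cast : ∀ {m n} (eq : m ≡ n) {f} → IsCoboundary m f → IsCoboundary n (castᶜ eq f)
      coboundary-cast ≡.refl p = p

      coboundary-uncast : ∀ {m n} (eq : m ≡ n) {f} → IsCoboundary n (castᶜ eq f) → IsCoboundary m f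
      coboundary-uncast ≡.refl p = p

    -- Z^r(G,A)
    record Cocycle (r : ℕ) : Set (g ⊔ c ⊔ ℓ) where
      constructor mkCocycle
      field
        cochain : Cochain A r
        closed  : d cochain ≈ᶜ 0ᶜ

  open Cocycle

  infix 4 _~_

  -- Two cochains are cohomologous when they differ by a coboundary.
  record _~_ {c ℓ} {A : DiscreteModule G c ℓ} {r} (f h : Cochain A r) : Set (g ⊔ c ⊔ ℓ) where
    constructor mk~
    field
      difference : IsCoboundary A r (f +ᶜ -ᶜ h)

  open _~_

  module _ {c ℓ} {A : DiscreteModule G c ℓ} {r : ℕ} where
    private
      module C  = AbelianGroup (C^ r A)
      module C₁ = AbelianGroup (C^ (suc r) A)
      module P  = AbelianGroupProperties (C^ r A)
      module P₁ = AbelianGroupProperties (C^ (suc r) A)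
      module S  = CommutativeSemigroupProperties C.commutativeSemigroup
      module D  = Additive (d-additive A {r})

    abstract
      ≈⇒~ : ∀ {f h : Cochain A r} → f ≈ᶜ h → f ~ h
      ≈⇒~ p = mk~ (coboundary-resp A r (C.sym (P.x≈y⇒x∙y⁻¹≈ε p)) (coboundary-0 A r))

      ~-sym : ∀ {f h : Cochain A r} → f ~ h → h ~ f
      ~-sym {f} {h} p = mk~ (coboundary-resp A r (P.⁻¹-anti-homo‿- f h) (coboundary-neg A r (difference p)))

      ~-trans : ∀ {f h k : Cochain A r} → f ~ h → h ~ k → f ~ k
      ~-trans {f} {h} {k} p q = mk~ (coboundary-resp A r
        (C.trans (C.assoc f (-ᶜ h) (h +ᶜ -ᶜ k)) (C.∙-congˡ {f} (P.\\-leftDividesʳ h (-ᶜ k))))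
        (coboundary-+ A r (difference p) (difference q)))

      ~-+ : ∀ {f h f₁ h₁ : Cochain A r} → f ~ h → f₁ ~ h₁ → (f +ᶜ f₁) ~ (h +ᶜ h₁)
      ~-+ {f} {h} {f₁} {h₁} p q = mk~ (coboundary-resp A r
        (C.trans (S.interchange f (-ᶜ h) f₁ (-ᶜ h₁)) (C.∙-congˡ {f +ᶜ f₁} (P.⁻¹-∙-comm h h₁)))
        (coboundary-+ A r (difference p) (difference q)))

      ~-neg : ∀ {f h : Cochain A r} → f ~ h → (-ᶜ f) ~ (-ᶜ h)
      ~-neg {f} {h} p = mk~ (coboundary-resp A r (C.sym (P.⁻¹-∙-comm f (-ᶜ h))) (coboundary-neg A r (difference p)))

      +-closed : (α β : Cocycle A r) → d (cochain α +ᶜ cochain β) ≈ᶜ 0ᶜ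
      +-closed α β = C₁.trans (D.φ-+ (cochain α) (cochain β))
        (C₁.trans (C₁.∙-cong (closed α) (closed β)) (C₁.identityˡ 0ᶜ))

      -‿closed : (α : Cocycle A r) → d (-ᶜ cochain α) ≈ᶜ 0ᶜ
      -‿closed α = C₁.trans (D.φ-‿ (cochain α)) (C₁.trans (C₁.⁻¹-cong (closed α)) P₁.ε⁻¹≈ε)

    _+ᶻ_ : Cocycle A r → Cocycle A r → Cocycle A r
    α +ᶻ β = mkCocycle (cochain α +ᶜ cochain β) (+-closed α β)

    -ᶻ_ : Cocycle A r → Cocycle A r
    -ᶻ α = mkCocycle (-ᶜ cochain α) (-‿closed α)

    0ᶻ : Cocycle A r
    0ᶻ = mkCocycle 0ᶜ D.φ-0

    _~ᶻ_ : Cocycle A r → Cocycle A r → Set (g ⊔ c ⊔ ℓ)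
    α ~ᶻ β = cochain α ~ cochain β

    abstract
      +ᶻ-isAbelianGroup : IsAbelianGroup _~ᶻ_ _+ᶻ_ 0ᶻ -ᶻ_
      +ᶻ-isAbelianGroup = record
        { isGroup = record
          { isMonoid = record
            { isSemigroup = record
              { isMagma = record
                { isEquivalence = record { refl = ≈⇒~ C.refl ; sym = ~-sym ; trans = ~-trans }
                ; ∙-cong = ~-+ }
              ; assoc = λ α β γ → ≈⇒~ (C.assoc (cochain α) (cochain β) (cochain γ)) }
            ; identity = (λ α → ≈⇒~ (C.identityˡ (cochain α))) , (λ α → ≈⇒~ (C.identityʳ (cochain α))) }
          ; inverse = (λ α → ≈⇒~ (C.inverseˡ (cochain α))) , (λ α → ≈⇒~ (C.inverseʳ (cochain α)))
          ; ⁻¹-cong = ~-neg }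
        ; comm = λ α β → ≈⇒~ (C.comm (cochain α) (cochain β)) }

  -- H^r(G,A) = Z^r/B^r: cocycles, equal when they differ by a coboundary.
  H^ : ∀ {c ℓ} → ℕ → DiscreteModule G c ℓ → AbelianGroup (g ⊔ c ⊔ ℓ) (g ⊔ c ⊔ ℓ)
  H^ r A = record { isAbelianGroup = +ᶻ-isAbelianGroup {A = A} {r} }

------------------------------------------------------------------------
-- Maps induced on cochains

  module _ {c₁ ℓ₁ c₂ ℓ₂} {A : DiscreteModule G c₁ ℓ₁} {B : DiscreteModule G c₂ ℓ₂} (φ : ModuleHom A B) where
    open ModuleHom φ
    private
      module A = DiscreteModule A
      module B = DiscreteModule B

    infixr 9 _∗_
    _∗_ : ∀ {r} → Cochain A r → Cochain B r
    _∗_ f = mkCochain (λ xs → ⟦ fun f xs ⟧) (map-continuous A.setoid B.setoid ⟦_⟧ ⟦⟧-cong (continuous f))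

    ∗-additive : ∀ {r} → Additive (C^ r A) (C^ r B) _∗_
    ∗-additive = record
      { φ-cong = λ p → pointwise (λ xs → ⟦⟧-cong (at p xs))
      ; φ-+    = λ f h → pointwise (λ xs → homo _ _) }

    ∗-d : ∀ {r} (f : Cochain A r) → _∗_ (d f) ≈ᶜ d (_∗_ f)
    ∗-d {r} f = pointwise λ { (x ∷ xs) →
      B.trans (⟦⟧-cong (d≈T A r (fun f) x xs))
        (B.trans (homo _ _)
          (B.trans (B.+-cong (equivariant x _) (B.sym (T-map A B additive r (fun f) (x ∷ xs))))
            (B.sym (d≈T B r (λ ys → ⟦ fun f ys ⟧) x xs)))) }

  module _ {c₁ ℓ₁ c₂ ℓ₂ c₃ ℓ₃} {A : DiscreteModule G c₁ ℓ₁} {B : DiscreteModule G c₂ ℓ₂}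
           {C : DiscreteModule G c₃ ℓ₃} (β : Bilinear A B C) where
    open Bilinear β
    private
      module A = DiscreteModule A
      module B = DiscreteModule B
      module C = DiscreteModule C

    cup-additiveˡ : ∀ {r s} (h : Cochain B s) → Additive (C^ r A) (C^ (r ℕ+ s) C) (λ f → cup β f h)
    cup-additiveˡ h = record
      { φ-cong = λ p → pointwise λ xs → ⊗-cong (at p _) B.refl
      ; φ-+    = λ f f₁ → pointwise λ xs → ⊗-+ˡ _ _ _ }

    cup-additiveʳ : ∀ {r s} (f : Cochain A r) → Additive (C^ s B) (C^ (r ℕ+ s) C) (cup β f)
    cup-additiveʳ {r} f = record
      { φ-cong = λ p → pointwise λ xs → ⊗-cong A.refl (B.·-congˡ _ (at p _))
      ; φ-+    = λ h h₁ → pointwise λ xs →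
                   C.trans (⊗-cong A.refl (B.·-distrib-+ _ _ _)) (⊗-+ʳ _ _ _) }

    leibniz : ∀ {r s} (f : Cochain A r) (h : Cochain B s) →
              d (cup β f h) ≈ᶜ
              cup β (d f) h +ᶜ ([-1]^ (C^ (suc (r ℕ+ s)) C) r (castᶜ C (ℕ.+-suc r s) (cup β f (d h))))
    leibniz {r} {s} f h = pointwise λ { (x ∷ xs) → begin
      d-fun C (r ℕ+ s) (fun (cup β f h)) (x ∷ xs)
        ≈⟨ C.trans (d≈T C (r ℕ+ s) (fun (cup β f h)) x xs)
             (C.trans (C.+-cong (C.·-congˡ x (cup-fun β f h xs))
                                (T-cong C (r ℕ+ s) (fun (cup β f h)) F (cup-fun β f h) (x ∷ xs)))
                      (C.sym (d≈T C (r ℕ+ s) F x xs))) ⟩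
      d-fun C (r ℕ+ s) F (x ∷ xs)
        ≈⟨ d-Cup β r (fun f) (fun h) (x ∷ xs) ⟩
      Cup β G.ε (suc r) (d-fun A r (fun f)) (fun h) (x ∷ xs)
        C.+ [-1]^ C.abelianGroup r (Cup β G.ε r (fun f) (d-fun B s (fun h)) (Vec.cast (≡.sym (ℕ.+-suc r s)) (x ∷ xs)))
        ≈⟨ C.+-cong (cup-fun β (d f) h (x ∷ xs)) (S.φ-cong (cup-fun β f (d h) _)) ⟨
      fun (cup β (d f) h) (x ∷ xs)
        C.+ [-1]^ C.abelianGroup r (fun (cup β f (d h)) (Vec.cast (≡.sym (ℕ.+-suc r s)) (x ∷ xs)))
        ≡⟨ ≡.cong (λ u → fun (cup β (d f) h) (x ∷ xs) C.+ [-1]^ C.abelianGroup r u)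
             (castᶜ-fun C (ℕ.+-suc r s) (cup β f (d h)) (x ∷ xs)) ⟨
      fun (cup β (d f) h) (x ∷ xs)
        C.+ [-1]^ C.abelianGroup r (fun (castᶜ C (ℕ.+-suc r s) (cup β f (d h))) (x ∷ xs))
        ≈⟨ C.+-congˡ (Additive.φ-[-1]^ (eval-additive C (x ∷ xs)) r (castᶜ C (ℕ.+-suc r s) (cup β f (d h)))) ⟨
      fun (cup β (d f) h) (x ∷ xs)
        C.+ fun ([-1]^ (C^ (suc (r ℕ+ s)) C) r (castᶜ C (ℕ.+-suc r s) (cup β f (d h)))) (x ∷ xs) ∎ }
      where
      open SetoidReasoning C.setoid
      F = Cup β G.ε r (fun f) (fun h)
      module S = Additive ([-1]^-additive C.abelianGroup r)

  module _ {c ℓ} {A′ A A″ : DiscreteModule G c ℓ} (E : ShortExact A′ A A″) where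
    open ShortExact E
    private
      module A′ = DiscreteModule A′
      module A  = DiscreteModule A
      module A″ = DiscreteModule A″

    i∗-injective : ∀ {r} {f h : Cochain A′ r} → i ∗ f ≈ᶜ i ∗ h → f ≈ᶜ h
    i∗-injective p = pointwise λ xs → i-injective (at p xs)

    -- The identification of C^r(G,A′) with the kernel of j∗.
    ker-j∗ : ∀ {r} (f : Cochain A r) → j ∗ f ≈ᶜ 0ᶜ →
             ∃ λ (f′ : Cochain A′ r) → i ∗ f′ ≈ᶜ f
    ker-j∗ f p = mkCochain (λ xs → proj₁ (ker-j⊆im-i (fun f xs) (at p xs))) cont ,
                 pointwise (λ xs → proj₂ (ker-j⊆im-i (fun f xs) (at p xs)))
      where
      cont : G.Continuous A′.setoid (λ xs → proj₁ (ker-j⊆im-i (fun f xs) (at p xs)))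
      cont xs with continuous f xs
      ... | k , h = k , λ ys e → i-injective
        (A.trans (proj₂ (ker-j⊆im-i (fun f xs) (at p xs)))
          (A.trans (h ys e) (A.sym (proj₂ (ker-j⊆im-i (fun f ys) (at p ys))))))

    -- j∗ is surjective: a cochain is determined by its values at finitely
    -- many representatives, and these values can be lifted one by one.
    j∗-surjective : ∀ {r} (f″ : Cochain A″ r) → ∃ λ (f : Cochain A r) → j ∗ f ≈ᶜ f″
    j∗-surjective f″ =
      mkCochain (λ xs → proj₁ (j-surjective (fun f″ (G.rep k xs))))
        (λ xs → k , λ ys e → A.reflexive (≡.cong (λ zs → proj₁ (j-surjective (fun f″ zs))) (G.rep-unique k e))) ,
      pointwise (λ xs → A″.trans (proj₂ (j-surjective (fun f″ (G.rep k xs))))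
                                 (G.uniform A″.setoid (fun f″) (continuous f″) (G.rep-≋ k xs)))
      where
      k = G.modulus A″.setoid (fun f″) (continuous f″)

------------------------------------------------------------------------
-- Tate products

record TateProduct {g} (G : ProfiniteGroup g) (c ℓ : Level) : Set (g ⊔ lsuc (c ⊔ ℓ)) where
  field
    A′ A A″ B′ B B″ C : DiscreteModule G c ℓ
    exact-A : ShortExact A′ A A″
    exact-B : ShortExact B′ B B″
    A′×B→C  : Bilinear A′ B C
    A×B′→C  : Bilinear A B′ C

  module A′×B→C  = Bilinear A′×B→C
  module A×B′→C  = Bilinear A×B′→C
  module exact-A = ShortExact exact-A
  module exact-B = ShortExact exact-B
  module C       = DiscreteModule C

  field
    coincide : ∀ a′ b′ → a′ A′×B→C.⊗ exact-B.i⟦ b′ ⟧ C.≈ exact-A.i⟦ a′ ⟧ A×B′→C.⊗ b′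

module _ {g} {G : ProfiniteGroup g} where

  flipBilinear : ∀ {c₁ ℓ₁ c₂ ℓ₂ c₃ ℓ₃} {A : DiscreteModule G c₁ ℓ₁} {B : DiscreteModule G c₂ ℓ₂}
                 {C : DiscreteModule G c₃ ℓ₃} → Bilinear A B C → Bilinear B A C
  flipBilinear β = record
    { _⊗_         = λ b a → a ⊗ b
    ; ⊗-cong      = λ p q → ⊗-cong q p
    ; ⊗-+ˡ        = λ b b₁ a → ⊗-+ʳ a b b₁
    ; ⊗-+ʳ        = λ b a a₁ → ⊗-+ˡ a a₁ b
    ; equivariant = λ x b a → equivariant x a b
    }
    where open Bilinear β

  -- The flipped Tate product (B, A, C).
  flipTate : ∀ {c ℓ} → TateProduct G c ℓ → TateProduct G c ℓ
  flipTate T = record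
    { A′ = B′ ; A = B ; A″ = B″ ; B′ = A′ ; B = A ; B″ = A″ ; C = C
    ; exact-A  = exact-B
    ; exact-B  = exact-A
    ; A′×B→C   = flipBilinear A×B′→C
    ; A×B′→C   = flipBilinear A′×B→C
    ; coincide = λ b′ a′ → C.sym (coincide a′ b′)
    }
    where open TateProduct T

-- A choice of f ∈ C^r(G,A) for which j∗f is a cocycle representing α″;
-- d f is regarded as an element ∂f of C^{r+1}(G,A′), which forces j∗f to
-- be a cocycle.
record Choice {g} {G : ProfiniteGroup g} {c ℓ} {A′ A A″ : DiscreteModule G c ℓ} (E : ShortExact A′ A A″)
              {r : ℕ} (α″ : Cocycle A″ r) : Set (g ⊔ c ⊔ ℓ) where
  open ShortExact E
  field
    f          : Cochain A r
    ∂f         : Cochain A′ (suc r)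
    ∂f≈df      : i ∗ ∂f ≈ᶜ d f
    represents : j ∗ f ~ Cocycle.cochain α″

module _ {g} {G : ProfiniteGroup g} {c ℓ} {A′ A A″ : DiscreteModule G c ℓ} (E : ShortExact A′ A A″) where
  open ShortExact E
  open Cocycle
  open _~_

  choose : ∀ {r} (α″ : Cocycle A″ r) → Choice E α″
  choose {r} α″ = record { f = f ; ∂f = proj₁ ∂f ; ∂f≈df = proj₂ ∂f ; represents = ≈⇒~ (proj₂ lift) }
    where
    module C = AbelianGroup (C^ (suc r) A″)
    lift : ∃ λ (f : Cochain A r) → j ∗ f ≈ᶜ cochain α″
    lift = j∗-surjective E (cochain α″)
    f : Cochain A r
    f = proj₁ lift
    ∂f : ∃ λ (f′ : Cochain A′ (suc r)) → i ∗ f′ ≈ᶜ d f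
    ∂f = ker-j∗ E (d f) (C.trans (∗-d j f) (C.trans (Additive.φ-cong (d-additive A″) (proj₂ lift)) (closed α″)))

  i∗-closed : ∀ {r} (f : Cochain A r) (f′ : Cochain A′ (suc r)) → i ∗ f′ ≈ᶜ d f → d f′ ≈ᶜ 0ᶜ
  i∗-closed {r} f f′ p = i∗-injective E
    (C.trans (∗-d i f′) (C.trans (Additive.φ-cong (d-additive A) p)
      (C.trans (dd≈0 A f) (C.sym (Additive.φ-0 (∗-additive i))))))
    where module C = AbelianGroup (C^ (suc (suc r)) A)

  ∂-minus : ∀ {r} (f f₁ : Cochain A r) (f′ f₁′ : Cochain A′ (suc r)) → i ∗ f′ ≈ᶜ d f → i ∗ f₁′ ≈ᶜ d f₁ →
            i ∗ (f′ +ᶜ -ᶜ f₁′) ≈ᶜ d (f +ᶜ -ᶜ f₁)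
  ∂-minus {r} f f₁ f′ f₁′ p q = C.trans (I.φ-+ f′ (-ᶜ f₁′)) (C.trans (C.∙-cong p (C.trans (I.φ-‿ f₁′) (C.⁻¹-cong q)))
    (C.sym (C.trans (D.φ-+ f (-ᶜ f₁)) (C.∙-congˡ (D.φ-‿ f₁)))))
    where
    module C = AbelianGroup (C^ (suc r) A)
    module I = Additive (∗-additive i {suc r})
    module D = Additive (d-additive A {r})

  j-minus : ∀ {r} (f f₁ : Cochain A r) → j ∗ f ~ j ∗ f₁ → IsCoboundary A″ r (j ∗ (f +ᶜ -ᶜ f₁))
  j-minus {r} f f₁ p = coboundary-resp A″ r
    (C.sym (C.trans (J.φ-+ f (-ᶜ f₁)) (C.∙-congˡ (J.φ-‿ f₁)))) (difference p)
    where
    module C = AbelianGroup (C^ r A″)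
    module J = Additive (∗-additive j {r})

  -- If j∗f is a coboundary then f is the sum of a coboundary and a cochain of A′.
  split : ∀ r (f : Cochain A r) → IsCoboundary A″ r (j ∗ f) →
          ∃ λ (a : Cochain A′ r) → ∃ λ (e : Cochain A r) → IsCoboundary A r e × (i ∗ a +ᶜ e ≈ᶜ f)
  split zero    f (Level.lift p) =
    proj₁ a , 0ᶜ , coboundary-0 A zero , C.trans (C.identityʳ (i ∗ proj₁ a)) (proj₂ a)
    where
    module C = AbelianGroup (C^ 0 A)
    a : ∃ λ (a : Cochain A′ zero) → i ∗ a ≈ᶜ f
    a = ker-j∗ E f p
  split (suc r) f (h″ , p) = proj₁ a , d k , (k , C.refl) ,
    C.trans (C.∙-congʳ (proj₂ a)) (C.trans (C.assoc f (-ᶜ d k) (d k))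
      (C.trans (C.∙-congˡ (C.inverseˡ (d k))) (C.identityʳ f)))
    where
    module C  = AbelianGroup (C^ (suc r) A)
    module C″ = AbelianGroup (C^ (suc r) A″)
    module J  = Additive (∗-additive j {suc r})
    k : Cochain A r
    k = proj₁ (j∗-surjective E h″)
    j∗dk : j ∗ d k ≈ᶜ j ∗ f
    j∗dk = C″.trans (∗-d j k) (C″.trans (Additive.φ-cong (d-additive A″) (proj₂ (j∗-surjective E h″))) p)
    a : ∃ λ (a : Cochain A′ (suc r)) → i ∗ a ≈ᶜ f +ᶜ -ᶜ d k
    a = ker-j∗ E (f +ᶜ -ᶜ d k) (C″.trans (J.φ-+ f (-ᶜ d k)) (C″.trans (C″.∙-congˡ (J.φ-‿ (d k)))
          (C″.trans (C″.∙-congˡ (C″.⁻¹-cong j∗dk)) (C″.inverseʳ (j ∗ f)))))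

  split-∂ : ∀ {r} (f : Cochain A r) (f′ : Cochain A′ (suc r)) → i ∗ f′ ≈ᶜ d f →
            (a : Cochain A′ r) (e : Cochain A r) → IsCoboundary A r e → i ∗ a +ᶜ e ≈ᶜ f → f′ ≈ᶜ d a
  split-∂ {r} f f′ p a e q w = i∗-injective E
    (C.trans p (C.trans (D.φ-cong (C₀.sym w)) (C.trans (D.φ-+ (i ∗ a) e)
      (C.trans (C.∙-congˡ (coboundary⇒closed A r q)) (C.trans (C.identityʳ (d (i ∗ a))) (C.sym (∗-d i a)))))))
    where
    module C  = AbelianGroup (C^ (suc r) A)
    module C₀ = AbelianGroup (C^ r A)
    module D  = Additive (d-additive A {r})

module _ {g} {G : ProfiniteGroup g} {c₁ ℓ₁ c₂ ℓ₂ c₃ ℓ₃} {A : DiscreteModule G c₁ ℓ₁} {B : DiscreteModule G c₂ ℓ₂}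
         {C : DiscreteModule G c₃ ℓ₃} (β : Bilinear A B C) where
  private module CG n = AbelianGroup (C^ n C)

  leibniz-closedʳ : ∀ {r s} (f : Cochain A r) (h : Cochain B s) → d h ≈ᶜ 0ᶜ →
                    d (cup β f h) ≈ᶜ cup β (d f) h
  leibniz-closedʳ {r} {s} f h p = N.trans (leibniz β f h)
    (N.trans (N.∙-congˡ (N.trans (Additive.φ-cong ([-1]^-additive (C^ n C) r)
        (N.trans (K.φ-cong (M.trans (U.φ-cong p) U.φ-0)) K.φ-0))
        (Additive.φ-0 ([-1]^-additive (C^ n C) r))))
      (N.identityʳ (cup β (d f) h)))
    where
    n = suc (r ℕ+ s)
    module N = CG n
    module M = CG (r ℕ+ suc s)
    module K = Additive (castᶜ-additive C (ℕ.+-suc r s))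
    module U = Additive (cup-additiveʳ β {r} {suc s} f)

  leibniz-closedˡ : ∀ {r s} (f : Cochain A r) (h : Cochain B s) → d f ≈ᶜ 0ᶜ →
                    d (cup β f h) ≈ᶜ [-1]^ (C^ (suc (r ℕ+ s)) C) r (castᶜ C (ℕ.+-suc r s) (cup β f (d h)))
  leibniz-closedˡ {r} {s} f h p = N.trans (leibniz β f h)
    (N.trans (N.∙-congʳ (N.trans (U.φ-cong p) U.φ-0)) (N.identityˡ _))
    where
    module N = CG (suc (r ℕ+ s))
    module U = Additive (cup-additiveˡ β {suc r} {s} h)

  cup-coboundaryˡ : ∀ r {s} (e : Cochain A r) (h : Cochain B (suc s)) → IsCoboundary A r e → d h ≈ᶜ 0ᶜ →
                    IsCoboundary C (r ℕ+ suc s) (cup β e h)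
  cup-coboundaryˡ zero    {s} e h (Level.lift p) q =
    coboundary-resp C (suc s) (N.sym (N.trans (U.φ-cong p) U.φ-0)) (coboundary-0 C (suc s))
    where
    module N = CG (suc s)
    module U = Additive (cup-additiveˡ β {zero} h)
  cup-coboundaryˡ (suc r) {s} e h (k , p) q =
    cup β k h , N.trans (leibniz-closedʳ k h q) (Additive.φ-cong (cup-additiveˡ β h) p)
    where module N = CG (suc (r ℕ+ suc s))

  cup-coboundaryʳ : ∀ {r} s (f : Cochain A (suc r)) (e : Cochain B s) → d f ≈ᶜ 0ᶜ → IsCoboundary B s e →
                    IsCoboundary C (suc r ℕ+ s) (cup β f e)
  cup-coboundaryʳ {r} zero    f e q (Level.lift p) =
    coboundary-resp C (suc r ℕ+ 0) (N.sym (N.trans (U.φ-cong p) U.φ-0)) (coboundary-0 C (suc r ℕ+ 0))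
    where
    module N = CG (suc r ℕ+ 0)
    module U = Additive (cup-additiveʳ β {suc r} {zero} f)
  cup-coboundaryʳ {r} (suc s) f e q (k , p) =
    coboundary-resp C (suc r ℕ+ suc s) (Additive.φ-cong (cup-additiveʳ β f) p)
      (coboundary-uncast C (ℕ.+-suc (suc r) s)
        (coboundary-resp C n ([-1]^-invol (C^ n C) (suc r) X)
          (coboundary-[-1]^ C n (suc r) (cup β f k , leibniz-closedˡ f k q))))
    where
    n = suc (suc r ℕ+ s)
    X = castᶜ C (ℕ.+-suc (suc r) s) (cup β f (d k))

-- For homomorphisms φ and ψ,  φ x + ψ y  is additive in (x, y).
module _ {c ℓ c₁ ℓ₁ c₂ ℓ₂} {M : AbelianGroup c ℓ} {N : AbelianGroup c₁ ℓ₁} {P : AbelianGroup c₂ ℓ₂}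
         {φ : AbelianGroup.Carrier M → AbelianGroup.Carrier P}
         {ψ : AbelianGroup.Carrier N → AbelianGroup.Carrier P}
         (φ-add : Additive M P φ) (ψ-add : Additive N P ψ) where
  private
    module M = AbelianGroup M
    module N = AbelianGroup N
    module P = AbelianGroup P
    module φ = Additive φ-add
    module ψ = Additive ψ-add
  open CommutativeSemigroupProperties P.commutativeSemigroup using (interchange)
  open AbelianGroupProperties P using (⁻¹-∙-comm)

  sum-minus : ∀ x x₁ y y₁ → φ (x M.∙ x₁ M.⁻¹) P.∙ ψ (y N.∙ y₁ N.⁻¹) P.≈
                            (φ x P.∙ ψ y) P.∙ (φ x₁ P.∙ ψ y₁) P.⁻¹
  sum-minus x x₁ y y₁ = P.trans
    (P.∙-cong (P.trans (φ.φ-+ x _) (P.∙-congˡ (φ.φ-‿ x₁))) (P.trans (ψ.φ-+ y _) (P.∙-congˡ (ψ.φ-‿ y₁))))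
    (P.trans (interchange _ _ _ _) (P.∙-congˡ (⁻¹-∙-comm _ _)))

infixr 9 _∘ᵃ_
_∘ᵃ_ : ∀ {c ℓ c₁ ℓ₁ c₂ ℓ₂} {M : AbelianGroup c ℓ} {N : AbelianGroup c₁ ℓ₁} {P : AbelianGroup c₂ ℓ₂}
       {ψ : AbelianGroup.Carrier N → AbelianGroup.Carrier P}
       {φ : AbelianGroup.Carrier M → AbelianGroup.Carrier N} →
       Additive N P ψ → Additive M N φ → Additive M P (ψ ∘ φ)
_∘ᵃ_ {P = P} ψ φ = record
  { φ-cong = λ p → Additive.φ-cong ψ (Additive.φ-cong φ p)
  ; φ-+    = λ x y → AbelianGroup.trans P (Additive.φ-cong ψ (Additive.φ-+ φ x y)) (Additive.φ-+ ψ _ _) }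

------------------------------------------------------------------------
-- The augmented cup product

module _ {g} {G : ProfiniteGroup g} {c ℓ} (T : TateProduct G c ℓ) where
  open TateProduct T hiding (module C)
  open Cocycle
  private
    module CG n = AbelianGroup (C^ n C)
    module iA = ModuleHom exact-A.i
    module iB = ModuleHom exact-B.i

  -- d f ∪ h + (-1)^r f ∪ d h, where f′ and h′ are d f and d h regarded
  -- as cochains of A′ and B′.
  augᶜ : ∀ {r s} → Cochain A r → Cochain A′ (suc r) → Cochain B s → Cochain B′ (suc s) →
         Cochain C (suc (r ℕ+ s))
  augᶜ {r} {s} f f′ h h′ =
    cup A′×B→C f′ h +ᶜ [-1]^ (C^ (suc (r ℕ+ s)) C) r (castᶜ C (ℕ.+-suc r s) (cup A×B′→C f h′))

  coincideᶜ : ∀ {r s} (a′ : Cochain A′ r) (b′ : Cochain B′ s) →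
              cup A′×B→C a′ (exact-B.i ∗ b′) ≈ᶜ cup A×B′→C (exact-A.i ∗ a′) b′
  coincideᶜ a′ b′ = pointwise λ xs → TateProduct.C.trans T
    (A′×B→C.⊗-cong (DiscreteModule.refl A′) (DiscreteModule.sym B (iB.equivariant _ _))) (coincide _ _)

  module _ {r s : ℕ} where
    private
      n = suc (r ℕ+ s)
      module N = CG n
      module S = Additive ([-1]^-additive (C^ n C) r)
      module K = Additive (castᶜ-additive C (ℕ.+-suc r s))

    second-additiveˡ : ∀ h′ → Additive (C^ r A) (C^ n C)
                         (λ f → [-1]^ (C^ n C) r (castᶜ C (ℕ.+-suc r s) (cup A×B′→C f h′)))
    second-additiveˡ h′ =
      [-1]^-additive (C^ n C) r ∘ᵃ castᶜ-additive C (ℕ.+-suc r s) ∘ᵃ cup-additiveˡ A×B′→C h′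

    second-additiveʳ : ∀ f → Additive (C^ (suc s) B′) (C^ n C)
                         (λ h′ → [-1]^ (C^ n C) r (castᶜ C (ℕ.+-suc r s) (cup A×B′→C f h′)))
    second-additiveʳ f =
      [-1]^-additive (C^ n C) r ∘ᵃ castᶜ-additive C (ℕ.+-suc r s) ∘ᵃ cup-additiveʳ A×B′→C f

    module _ (f : Cochain A r) (f′ : Cochain A′ (suc r)) (h : Cochain B s) (h′ : Cochain B′ (suc s))
             (p : exact-A.i ∗ f′ ≈ᶜ d f) (q : exact-B.i ∗ h′ ≈ᶜ d h) where

      private
        df′≈0 : d f′ ≈ᶜ 0ᶜ
        df′≈0 = i∗-closed exact-A f f′ p

        dh′≈0 : d h′ ≈ᶜ 0ᶜ
        dh′≈0 = i∗-closed exact-B h h′ q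

      augᶜ-closed : d (augᶜ f f′ h h′) ≈ᶜ 0ᶜ
      augᶜ-closed = N₁.trans (D.φ-+ _ _) (N₁.trans (N₁.∙-cong first second) (N₁.inverseˡ Y))
        where
        module N₁ = CG (suc n)
        module N₂ = CG (suc r ℕ+ suc s)
        module D  = Additive (d-additive C {n})
        module S₁ = Additive ([-1]^-additive (C^ (suc n) C) r)
        module K₁ = Additive (castᶜ-additive C (ℕ.+-suc (suc r) s))
        X : Cochain C (suc r ℕ+ suc s)
        X = cup A×B′→C (d f) h′
        Y : Cochain C (suc n)
        Y = [-1]^ (C^ (suc n) C) r (castᶜ C (ℕ.+-suc (suc r) s) X)
        first : d (cup A′×B→C f′ h) ≈ᶜ -ᶜ Y
        first = N₁.trans (leibniz-closedˡ A′×B→C f′ h df′≈0)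
          (N₁.⁻¹-cong (S₁.φ-cong (K₁.φ-cong
            (N₂.trans (Additive.φ-cong (cup-additiveʳ A′×B→C f′) (AbelianGroup.sym (C^ (suc s) B) q))
              (N₂.trans (coincideᶜ f′ h′) (Additive.φ-cong (cup-additiveˡ A×B′→C h′) p))))))
        second : d ([-1]^ (C^ n C) r (castᶜ C (ℕ.+-suc r s) (cup A×B′→C f h′))) ≈ᶜ Y
        second = N₁.trans (Additive.φ-[-1]^ (d-additive C) r _)
          (S₁.φ-cong (N₁.trans (N₁.sym (castᶜ-d C (ℕ.+-suc r s) (cup A×B′→C f h′)))
            (K₁.φ-cong (leibniz-closedʳ A×B′→C f h′ dh′≈0))))

      augᶜ-coboundaryˡ : IsCoboundary A″ r (exact-A.j ∗ f) → IsCoboundary C n (augᶜ f f′ h h′)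
      augᶜ-coboundaryˡ w with split exact-A r f w
      ... | a , e , e-cob , f≈ = coboundary-resp C n (N.sym eq)
        (coboundary-+ C n (cup A′×B→C a h , N.refl)
          (coboundary-[-1]^ C n r (coboundary-cast C (ℕ.+-suc r s) (cup-coboundaryˡ A×B′→C r e h′ e-cob dh′≈0))))
        where
        φ : Cochain A r → Cochain C n
        φ k = [-1]^ (C^ n C) r (castᶜ C (ℕ.+-suc r s) (cup A×B′→C k h′))
        module φ = Additive (second-additiveˡ h′)
        f′≈da : f′ ≈ᶜ d a
        f′≈da = split-∂ exact-A f f′ p a e e-cob f≈
        ia : cup A×B′→C (exact-A.i ∗ a) h′ ≈ᶜ cup A′×B→C a (d h)
        ia = AbelianGroup.trans (C^ (r ℕ+ suc s) C) (AbelianGroup.sym (C^ (r ℕ+ suc s) C) (coincideᶜ a h′))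
               (Additive.φ-cong (cup-additiveʳ A′×B→C a) q)
        eq : augᶜ f f′ h h′ ≈ᶜ d (cup A′×B→C a h) +ᶜ φ e
        eq = N.trans (N.∙-cong (Additive.φ-cong (cup-additiveˡ A′×B→C h) f′≈da)
                       (N.trans (φ.φ-cong (AbelianGroup.sym (C^ r A) f≈))
                         (N.trans (φ.φ-+ (exact-A.i ∗ a) e) (N.∙-congʳ (S.φ-cong (K.φ-cong ia))))))
               (N.trans (N.sym (N.assoc _ _ _)) (N.∙-congʳ (N.sym (leibniz A′×B→C a h))))

      augᶜ-coboundaryʳ : IsCoboundary B″ s (exact-B.j ∗ h) → IsCoboundary C n (augᶜ f f′ h h′)
      augᶜ-coboundaryʳ w with split exact-B s h w
      ... | b , e , e-cob , h≈ = coboundary-resp C n (N.sym eq)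
        (coboundary-+ C n (cup-coboundaryʳ A′×B→C s f′ e df′≈0 e-cob) (cup A×B′→C f b , N.refl))
        where
        module U = Additive (cup-additiveʳ A′×B→C {suc r} {s} f′)
        h′≈db : h′ ≈ᶜ d b
        h′≈db = split-∂ exact-B h h′ q b e e-cob h≈
        ib : cup A′×B→C f′ (exact-B.i ∗ b) ≈ᶜ cup A×B′→C (d f) b
        ib = N.trans (coincideᶜ f′ b) (Additive.φ-cong (cup-additiveˡ A×B′→C b) p)
        eq : augᶜ f f′ h h′ ≈ᶜ cup A′×B→C f′ e +ᶜ d (cup A×B′→C f b)
        eq = N.trans (N.∙-cong
                       (N.trans (U.φ-cong (AbelianGroup.sym (C^ s B) h≈))
                         (N.trans (U.φ-+ (exact-B.i ∗ b) e) (N.trans (N.∙-congʳ ib) (N.comm _ _))))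
                       (Additive.φ-cong (second-additiveʳ f) h′≈db))
               (N.trans (N.assoc _ _ _) (N.∙-congˡ (N.sym (leibniz A×B′→C f b))))

    open Choice

    augOf : ∀ {α″ : Cocycle A″ r} {β″ : Cocycle B″ s} →
            Choice exact-A α″ → Choice exact-B β″ → Cocycle C n
    augOf x y = mkCocycle (augᶜ (f x) (∂f x) (f y) (∂f y))
                          (augᶜ-closed (f x) (∂f x) (f y) (∂f y) (∂f≈df x) (∂f≈df y))

    -- The class of  augOf x y  depends only on the classes of α″ and β″.
    augOf-wellDefined : ∀ {α″ α₁ : Cocycle A″ r} {β″ β₁ : Cocycle B″ s} → α″ ~ᶻ α₁ → β″ ~ᶻ β₁ →
                        (x : Choice exact-A α″) (x₁ : Choice exact-A α₁)
                        (y : Choice exact-B β″) (y₁ : Choice exact-B β₁) → augOf x y ~ᶻ augOf x₁ y₁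
    augOf-wellDefined {α″} {α₁} {β″} {β₁} p q x x₁ y y₁ = ~-trans left right
      where
      left : augᶜ (f x) (∂f x) (f y) (∂f y) ~ augᶜ (f x₁) (∂f x₁) (f y) (∂f y)
      left = mk~ (coboundary-resp C n
        (sum-minus (cup-additiveˡ A′×B→C (f y)) (second-additiveˡ (∂f y)) (∂f x) (∂f x₁) (f x) (f x₁))
        (augᶜ-coboundaryˡ (f x +ᶜ -ᶜ f x₁) (∂f x +ᶜ -ᶜ ∂f x₁) (f y) (∂f y)
          (∂-minus exact-A (f x) (f x₁) (∂f x) (∂f x₁) (∂f≈df x) (∂f≈df x₁)) (∂f≈df y)
          (j-minus exact-A (f x) (f x₁) (~-trans (represents x) (~-trans p (~-sym (represents x₁)))))))
      right : augᶜ (f x₁) (∂f x₁) (f y) (∂f y) ~ augᶜ (f x₁) (∂f x₁) (f y₁) (∂f y₁)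
      right = mk~ (coboundary-resp C n
        (sum-minus (cup-additiveʳ A′×B→C (∂f x₁)) (second-additiveʳ (f x₁)) (f y) (f y₁) (∂f y) (∂f y₁))
        (augᶜ-coboundaryʳ (f x₁) (∂f x₁) (f y +ᶜ -ᶜ f y₁) (∂f y +ᶜ -ᶜ ∂f y₁)
          (∂f≈df x₁) (∂-minus exact-B (f y) (f y₁) (∂f y) (∂f y₁) (∂f≈df y) (∂f≈df y₁))
          (j-minus exact-B (f y) (f y₁) (~-trans (represents y) (~-trans q (~-sym (represents y₁)))))))

  -- The augmented cup product H^r(G,A″) × H^s(G,B″) → H^{r+s+1}(G,C).
  augCup : ∀ {r s} → AbelianGroup.Carrier (H^ r A″) → AbelianGroup.Carrier (H^ s B″) →
           AbelianGroup.Carrier (H^ (suc (r ℕ+ s)) C)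
  augCup α″ β″ = augOf (choose exact-A α″) (choose exact-B β″)

  augCup-cong : ∀ {r s} {α″ α₁ : Cocycle A″ r} {β″ β₁ : Cocycle B″ s} → α″ ~ᶻ α₁ → β″ ~ᶻ β₁ →
                augCup α″ β″ ~ᶻ augCup α₁ β₁
  augCup-cong p q = augOf-wellDefined p q (choose exact-A _) (choose exact-A _) (choose exact-B _) (choose exact-B _)

  augCup-anyChoice : ∀ {r s} {α″ : Cocycle A″ r} {β″ : Cocycle B″ s}
                     (x : Choice exact-A α″) (y : Choice exact-B β″) → augCup α″ β″ ~ᶻ augOf x y
  augCup-anyChoice {r} {s} {α″} {β″} x y = augOf-wellDefined
    (AbelianGroup.refl (H^ r A″) {α″}) (AbelianGroup.refl (H^ s B″) {β″})
    (choose exact-A α″) x (choose exact-B β″) y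

{-# OPTIONS --safe #-}

-- Steenrod's cup-one product is a homotopy between f ∪ h and h ∪ f which is
-- natural in the pairing: for f of degree r + 1 and h of degree s,
--   d (f ∪₁ h) = f ∪₁ dh - (-1)ˢ df ∪₁ h + (-1)ˢ h ∪ f - (-1)ʳˢ f ∪ h .
-- Lift α″ and β″ to f ∈ C^r(G,A) and h ∈ C^s(G,B).  As df and dh are cocycles of
-- A′ and B′, the boundaries of df ∪₁ h and f ∪₁ dh compare the two summands of
-- the augmented cup products, up to a term df ∪₁ dh each.  The two pairings
-- coincide on A′ × B′, so these terms are equal, and they enter with opposite signs.
module Submission where

open import Defs
open import Algebra.Bundles using (AbelianGroup)
import Algebra.Properties.AbelianGroup as AbelianGroupProperties
import Algebra.Solver.CommutativeMonoid as CommutativeMonoidSolver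
open import Data.Fin.Base using () renaming (zero to fzero)
open import Data.Nat.Base using (ℕ; zero; suc; _+_; _*_)
open import Data.Nat.Properties using (+-comm)
import Data.Nat.Properties as ℕ
open import Data.Product.Base using (_,_; proj₁; proj₂)
open import Data.Vec.Base using (Vec; []; _∷_; cast; take; drop; head; tail)
open import Data.Vec.Properties using (cast-is-id; cast-trans)
open import Data.Vec.Relation.Binary.Pointwise.Inductive using ([]; _∷_)
open import Level using (Level)
open import Relation.Binary.PropositionalEquality as ≡ using (_≡_; cong; subst)
import Relation.Binary.Reasoning.Setoid as SetoidReasoning

-- Sign identities in an abelian group.

module SignAlgebra {c ℓ} (M : AbelianGroup c ℓ) {S : AbelianGroup.Carrier M → AbelianGroup.Carrier M}
                   (S-additive : Additive M M S) where
  open AbelianGroup M renaming (_∙_ to infixl 6 _⊕ᵐ_; _⁻¹ to infix 8 -_)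
  open AbelianGroupProperties M using (⁻¹-∙-comm; ⁻¹-involutive)
  open CommutativeMonoidSolver commutativeMonoid using (solve; _⊜_; _⊕_)
  open SetoidReasoning setoid
  private module S = Additive S-additive

  pair-cancel : ∀ {x y z} → x ⊕ᵐ y ≈ ε → z ≈ (x ⊕ᵐ y) ⊕ᵐ z
  pair-cancel {z = z} p = trans (sym (identityˡ z)) (∙-congʳ (sym p))

  module _ (S-involutive : ∀ x → S (S x) ≈ x) where

    -- Serves the base case of `T-K`, where `S` is the sign `(-1)^(s+1)`. On the right `x` occurs as
    -- head term of `δ₂` and, negated, as a merge of `T₁`. Likewise `c` occurs as the last term of
    -- `T₁` and, negated, as the cup product. Both pairs sum to zero.
    homotopy-base : ∀ e₁ e₂ x c → e₁ ⊕ᵐ S e₂ ≈ ((x ⊕ᵐ e₁) ⊕ᵐ S (e₂ ⊕ᵐ S (- x ⊕ᵐ - - c))) ⊕ᵐ - c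
    homotopy-base e₁ e₂ x c = begin
      e₁ ⊕ᵐ S e₂
        ≈⟨ trans (pair-cancel (inverseʳ c)) (pair-cancel (inverseʳ x)) ⟩
      (x ⊕ᵐ - x) ⊕ᵐ ((c ⊕ᵐ - c) ⊕ᵐ (e₁ ⊕ᵐ S e₂))
        ≈⟨ solve 6 (λ x x⁻ c c⁻ e t → (x ⊕ x⁻) ⊕ ((c ⊕ c⁻) ⊕ (e ⊕ t)) ⊜ ((x ⊕ e) ⊕ (t ⊕ (x⁻ ⊕ c))) ⊕ c⁻)
             refl x (- x) c (- c) e₁ (S e₂) ⟩
      ((x ⊕ᵐ e₁) ⊕ᵐ (S e₂ ⊕ᵐ (- x ⊕ᵐ c))) ⊕ᵐ - c
        ≈⟨ ∙-congʳ (∙-congˡ (∙-congˡ (trans (S-involutive _) (∙-congˡ (⁻¹-involutive c))))) ⟨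
      ((x ⊕ᵐ e₁) ⊕ᵐ (S e₂ ⊕ᵐ S (S (- x ⊕ᵐ - - c)))) ⊕ᵐ - c
        ≈⟨ ∙-congʳ (∙-congˡ (S.φ-+ _ _)) ⟨
      ((x ⊕ᵐ e₁) ⊕ᵐ S (e₂ ⊕ᵐ S (- x ⊕ᵐ - - c))) ⊕ᵐ - c ∎

    -- Serves the inductive step of `T-K`: `e₁`, `e₂` come from the summand `i = 0`, `k₁` from
    -- multiplying the first two variables, and `k₂`, `k₃`, `c` from the induction hypothesis. Only
    -- `x` has to be inserted with both signs.
    homotopy-step : ∀ e₁ e₂ k₁ k₂ k₃ x c →
                    (e₁ ⊕ᵐ S e₂) ⊕ᵐ (- S k₁ ⊕ᵐ - S ((k₂ ⊕ᵐ S k₃) ⊕ᵐ - c)) ≈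
                    (((x ⊕ᵐ e₁) ⊕ᵐ - S k₂) ⊕ᵐ S (e₂ ⊕ᵐ S (- (x ⊕ᵐ S k₁) ⊕ᵐ - k₃))) ⊕ᵐ S c
    homotopy-step e₁ e₂ k₁ k₂ k₃ x c = begin
      (e₁ ⊕ᵐ S e₂) ⊕ᵐ (- S k₁ ⊕ᵐ - S ((k₂ ⊕ᵐ S k₃) ⊕ᵐ - c))
        ≈⟨ ∙-congˡ (∙-congˡ left) ⟩
      (e₁ ⊕ᵐ S e₂) ⊕ᵐ (- S k₁ ⊕ᵐ ((- S k₂ ⊕ᵐ - k₃) ⊕ᵐ S c))
        ≈⟨ pair-cancel (inverseʳ x) ⟩
      (x ⊕ᵐ - x) ⊕ᵐ ((e₁ ⊕ᵐ S e₂) ⊕ᵐ (- S k₁ ⊕ᵐ ((- S k₂ ⊕ᵐ - k₃) ⊕ᵐ S c)))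
        ≈⟨ solve 8 (λ x x⁻ e t p q u v → (x ⊕ x⁻) ⊕ ((e ⊕ t) ⊕ (p ⊕ ((q ⊕ u) ⊕ v))) ⊜
                                         (((x ⊕ e) ⊕ q) ⊕ (t ⊕ ((x⁻ ⊕ p) ⊕ u))) ⊕ v)
             refl x (- x) e₁ (S e₂) (- S k₁) (- S k₂) (- k₃) (S c) ⟩
      (((x ⊕ᵐ e₁) ⊕ᵐ - S k₂) ⊕ᵐ (S e₂ ⊕ᵐ ((- x ⊕ᵐ - S k₁) ⊕ᵐ - k₃))) ⊕ᵐ S c
        ≈⟨ ∙-congʳ (∙-congˡ (∙-congˡ (trans (S-involutive _) (∙-congʳ (sym (⁻¹-∙-comm _ _)))))) ⟨
      (((x ⊕ᵐ e₁) ⊕ᵐ - S k₂) ⊕ᵐ (S e₂ ⊕ᵐ S (S (- (x ⊕ᵐ S k₁) ⊕ᵐ - k₃)))) ⊕ᵐ S c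
        ≈⟨ ∙-congʳ (∙-congˡ (S.φ-+ _ _)) ⟨
      (((x ⊕ᵐ e₁) ⊕ᵐ - S k₂) ⊕ᵐ S (e₂ ⊕ᵐ S (- (x ⊕ᵐ S k₁) ⊕ᵐ - k₃))) ⊕ᵐ S c ∎
      where
      left : - S ((k₂ ⊕ᵐ S k₃) ⊕ᵐ - c) ≈ (- S k₂ ⊕ᵐ - k₃) ⊕ᵐ S c
      left = begin
        - S ((k₂ ⊕ᵐ S k₃) ⊕ᵐ - c)          ≈⟨ ⁻¹-cong (trans (S.φ-+ _ _) (∙-cong (S.φ-+ _ _) (S.φ-‿ c))) ⟩
        - ((S k₂ ⊕ᵐ S (S k₃)) ⊕ᵐ - S c)    ≈⟨ ⁻¹-∙-comm _ _ ⟨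
        - (S k₂ ⊕ᵐ S (S k₃)) ⊕ᵐ - - S c    ≈⟨ ∙-cong (trans (⁻¹-cong (∙-congˡ (S-involutive k₃))) (sym (⁻¹-∙-comm _ _)))
                                                     (⁻¹-involutive _) ⟩
        (- S k₂ ⊕ᵐ - k₃) ⊕ᵐ S c            ∎

    -- Serves the passage from `T` to the full coboundary: `S v` and its opposite `n` are inserted,
    -- so that `v` and `S w` together form the terms of `df ∪₁ h` in which the head of `df` acts on
    -- `f`.
    coboundary-step : ∀ w a t v n e → S v ⊕ᵐ n ≈ ε →
                      w ⊕ᵐ ((a ⊕ᵐ S t) ⊕ᵐ e) ≈ (a ⊕ᵐ S ((v ⊕ᵐ S w) ⊕ᵐ t)) ⊕ᵐ (n ⊕ᵐ e)
    coboundary-step w a t v n e p = begin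
      w ⊕ᵐ ((a ⊕ᵐ S t) ⊕ᵐ e)
        ≈⟨ pair-cancel p ⟩
      (S v ⊕ᵐ n) ⊕ᵐ (w ⊕ᵐ ((a ⊕ᵐ S t) ⊕ᵐ e))
        ≈⟨ solve 6 (λ v n w a t e → (v ⊕ n) ⊕ (w ⊕ ((a ⊕ t) ⊕ e)) ⊜ (a ⊕ ((v ⊕ w) ⊕ t)) ⊕ (n ⊕ e))
             refl (S v) n w a (S t) e ⟩
      (a ⊕ᵐ ((S v ⊕ᵐ w) ⊕ᵐ S t)) ⊕ᵐ (n ⊕ᵐ e)
        ≈⟨ ∙-congʳ (∙-congˡ (trans (S.φ-+ _ _) (∙-congʳ (trans (S.φ-+ _ _) (∙-congˡ (S-involutive w)))))) ⟨
      (a ⊕ᵐ S ((v ⊕ᵐ S w) ⊕ᵐ t)) ⊕ᵐ (n ⊕ᵐ e) ∎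

φ-≈0 : ∀ {c₁ ℓ₁ c₂ ℓ₂} (M : AbelianGroup c₁ ℓ₁) (N : AbelianGroup c₂ ℓ₂) {φ} → Additive M N φ →
       ∀ {x} → AbelianGroup._≈_ M x (AbelianGroup.ε M) → AbelianGroup._≈_ N (φ x) (AbelianGroup.ε N)
φ-≈0 M N φ-additive p = AbelianGroup.trans N (φ.φ-cong p) φ.φ-0
  where module φ = Additive φ-additive

[-1]^-+ : ∀ {c ℓ} (M : AbelianGroup c ℓ) m n x →
          AbelianGroup._≈_ M ([-1]^ M (m + n) x) ([-1]^ M m ([-1]^ M n x))
[-1]^-+ M zero    n x = AbelianGroup.refl M
[-1]^-+ M (suc m) n x = AbelianGroup.⁻¹-cong M ([-1]^-+ M m n x)

module _ {c ℓ} (M : AbelianGroup c ℓ) where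
  open AbelianGroup M renaming (_∙_ to infixl 6 _⊕ᵐ_; _⁻¹ to infix 8 -_)
  open AbelianGroupProperties M using (⁻¹-∙-comm; ⁻¹-involutive)
  open CommutativeMonoidSolver commutativeMonoid using (solve; _⊜_; _⊕_)
  open SetoidReasoning setoid
  private
    sgn : ℕ → Carrier → Carrier
    sgn = [-1]^ M
    module S n = Additive ([-1]^-additive M n)

  -- The form that `d-cup₁` takes when the left factor is a cocycle.
  boundary-dropʳ : ∀ s {z a b k e} → z ≈ (a ⊕ᵐ sgn s b) ⊕ᵐ e → a ≈ k → b ≈ ε → z ≈ k ⊕ᵐ e
  boundary-dropʳ s p a≈k b≈0 = trans p (∙-congʳ (trans
    (∙-cong a≈k (trans (S.φ-cong s b≈0) (S.φ-0 s))) (identityʳ _)))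

  -- The form that `d-cup₁` takes when the right factor is a cocycle of degree `s + 1`, multiplied
  -- by `(-1)^(s+1)` to free `u` from its sign.
  boundary-dropˡ : ∀ s m {z a k u x} → z ≈ (a ⊕ᵐ sgn (suc (suc s)) k) ⊕ᵐ (sgn (suc s) u ⊕ᵐ - sgn m x) → a ≈ ε →
                   sgn (suc s) z ≈ - k ⊕ᵐ (u ⊕ᵐ - sgn (suc s + m) x)
  boundary-dropˡ s m {z} {a} {k} {u} {x} p a≈0 = begin
    sgn (suc s) z
      ≈⟨ S.φ-cong (suc s) (trans p (∙-congʳ (trans (∙-congʳ a≈0) (identityˡ _)))) ⟩
    sgn (suc s) (- sgn (suc s) k ⊕ᵐ (sgn (suc s) u ⊕ᵐ - sgn m x))
      ≈⟨ trans (S.φ-+ (suc s) _ _) (∙-congˡ (S.φ-+ (suc s) _ _)) ⟩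
    sgn (suc s) (- sgn (suc s) k) ⊕ᵐ (sgn (suc s) (sgn (suc s) u) ⊕ᵐ sgn (suc s) (- sgn m x))
      ≈⟨ ∙-cong (trans (S.φ-‿ (suc s) _) (⁻¹-cong ([-1]^-invol M (suc s) k)))
                (∙-cong ([-1]^-invol M (suc s) u)
                  (trans (S.φ-‿ (suc s) _) (⁻¹-cong (sym ([-1]^-+ M (suc s) m x))))) ⟩
    - k ⊕ᵐ (u ⊕ᵐ - sgn (suc s + m) x) ∎

  boundary-zero : ∀ {k e} → k ≈ e → ε ≈ - k ⊕ᵐ e
  boundary-zero p = sym (trans (∙-congʳ (⁻¹-cong p)) (inverseˡ _))

  homotopies-cancel : ∀ m k u v w x → (k ⊕ᵐ (v ⊕ᵐ - sgn m w)) ⊕ᵐ (- k ⊕ᵐ (u ⊕ᵐ - sgn m x)) ≈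
                                      (u ⊕ᵐ v) ⊕ᵐ - sgn m (w ⊕ᵐ x)
  homotopies-cancel m k u v w x = begin
    (k ⊕ᵐ (v ⊕ᵐ - sgn m w)) ⊕ᵐ (- k ⊕ᵐ (u ⊕ᵐ - sgn m x))
      ≈⟨ solve 6 (λ k k⁻ u v w x → (k ⊕ (v ⊕ w)) ⊕ (k⁻ ⊕ (u ⊕ x)) ⊜ (k ⊕ k⁻) ⊕ ((u ⊕ v) ⊕ (w ⊕ x)))
           refl k (- k) u v (- sgn m w) (- sgn m x) ⟩
    (k ⊕ᵐ - k) ⊕ᵐ ((u ⊕ᵐ v) ⊕ᵐ (- sgn m w ⊕ᵐ - sgn m x))
      ≈⟨ trans (∙-congʳ (inverseʳ k)) (identityˡ _) ⟩
    (u ⊕ᵐ v) ⊕ᵐ (- sgn m w ⊕ᵐ - sgn m x)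
      ≈⟨ ∙-congˡ (trans (⁻¹-∙-comm _ _) (⁻¹-cong (sym (S.φ-+ m w x)))) ⟩
    (u ⊕ᵐ v) ⊕ᵐ - sgn m (w ⊕ᵐ x) ∎

  -- `(-1)^m` is its own inverse, so a relation solved for one side of a graded symmetry can be
  -- solved for the other.
  sign-transpose : ∀ m x y → sgn (suc m) (y ⊕ᵐ - sgn m x) ≈ x ⊕ᵐ - sgn m y
  sign-transpose m x y = begin
    - sgn m (y ⊕ᵐ - sgn m x)
      ≈⟨ ⁻¹-cong (trans (S.φ-+ m _ _) (∙-congˡ (trans (S.φ-‿ m _) (⁻¹-cong ([-1]^-invol M m x))))) ⟩
    - (sgn m y ⊕ᵐ - x)
      ≈⟨ ⁻¹-∙-comm _ _ ⟨
    - sgn m y ⊕ᵐ - - x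
      ≈⟨ trans (∙-congˡ (⁻¹-involutive x)) (comm _ _) ⟩
    x ⊕ᵐ - sgn m y ∎

-- Cup-one products of kernels.

-- A kernel φ stands for  λ a zs ws → f zs ⊗ a · h ws , where a accumulates x₁⋯xᵢ.
-- With kernels, cup-one products need neither A and B nor the pairing, and
-- are linear in one argument.
module Kernels {g} {G : ProfiniteGroup g} {c ℓ} (C : DiscreteModule G c ℓ) where
  private module G = ProfiniteGroup G
  open DiscreteModule C renaming (_+_ to infixl 6 _⊞_)
  open SetoidReasoning setoid
  open G using (_≋_; _≋[_]_; ∏; merge)

  V : ℕ → Set g
  V = Vec G.Carrier

  sgn : ℕ → Carrier → Carrier
  sgn = [-1]^ abelianGroup

  module sgn n = Additive ([-1]^-additive abelianGroup n)

  T-cast : ∀ {m n} (eq : m ≡ n) (f : V n → Carrier) xs →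
           T C m (λ ys → f (cast eq ys)) xs ≈ T C n f (cast (cong suc eq) xs)
  T-cast {m} ≡.refl f xs = trans
    (T-cong C m _ f (λ ys → reflexive (cong f (cast-is-id ≡.refl ys))) xs)
    (reflexive (cong (T C m f) (≡.sym (cast-is-id ≡.refl xs))))

  Kernel : ℕ → ℕ → Set _
  Kernel r s = G.Carrier → V r → V s → Carrier

  Congruent : ∀ {r s} → Kernel r s → Set _
  Congruent φ = ∀ {a b zs zs′ ws ws′} → a G.≈ b → zs ≋ zs′ → ws ≋ ws′ → φ a zs ws ≈ φ b zs′ ws′

  T₁ : ∀ {r s} → (V r → V s → Carrier) → V (suc r) → V s → Carrier
  T₁ {r} φ zs ws = T C r (λ xs → φ xs ws) zs

  T₂ : ∀ {r s} → (V r → V s → Carrier) → V r → V (suc s) → Carrier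
  T₂ {s = s} φ zs = T C s (φ zs)

  -- `T` never lets the first variable act, so absorbing `y` into that variable changes only the
  -- first merge, and there only by associativity.
  T-merge : ∀ r (f : V (suc r) → Carrier) → (∀ {xs ys} → xs ≋ ys → f xs ≈ f ys) → ∀ y zs →
            T C (suc r) (λ xs → f (merge fzero (y ∷ xs))) zs ≈ T C (suc r) f (merge fzero (y ∷ zs))
  T-merge zero    f f-cong y (p ∷ q ∷ [])      = +-congʳ (-‿cong (f-cong (G.sym (G.assoc y p q) ∷ [])))
  T-merge (suc r) f f-cong y (p ∷ q ∷ z ∷ zs) = +-congʳ (-‿cong (f-cong (G.sym (G.assoc y p q) ∷ G.≋-refl)))

  private
    E : ∀ s {r} → (V (suc r) → V s → Carrier) → V (s + r) → Carrier
    E s φ xs = φ (∏ (take s xs) ∷ drop s xs) (take s xs)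

  -- A merge inside the first `s + 1` variables keeps their product and is seen by `T₂`; the later
  -- terms are seen by `T₁`. Each side of the sum has one term too many: the last term of `T₂` and
  -- the first merge of `T₁` are equal up to sign, and they cancel.
  T-E : ∀ s r (φ : V (suc r) → V s → Carrier) →
        (∀ {zs zs′ ws} → zs ≋ zs′ → φ zs ws ≈ φ zs′ ws) → ∀ xs →
        T C (s + r) (E s φ) xs ≈ E (suc s) (T₂ φ) xs ⊞ sgn (suc s) (E s (T₁ φ) (cast (≡.sym (ℕ.+-suc s r)) xs))
  T-E zero r φ φ-cong (y ∷ ys) = begin
    t ys
      -- The block is empty: the only term of `T₂ φ` is its last one, and it cancels against the
      -- first merge of `T₁ φ`. Both are `u` up to sign.
      ≈⟨ x+[-x+y]≈y (- u) _ ⟨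
    - u ⊞ (- - u ⊞ t ys)
      ≈⟨ +-cong (-‿cong (φ-cong (G.trans (G.identityˡ y) (G.sym (G.identityʳ y)) ∷ G.≋-refl)))
                (+-congˡ (sym (-‿involutive _))) ⟩
    - φ (y G.∙ G.ε ∷ ys) [] ⊞ (- - u ⊞ - - t ys)
      ≈⟨ +-congˡ (-‿+-comm _ _) ⟩
    - φ (y G.∙ G.ε ∷ ys) [] ⊞ - (- u ⊞ - t ys)
      ≡⟨ cong (λ zs → - φ (y G.∙ G.ε ∷ ys) [] ⊞ - (- φ (G.ε G.∙ y ∷ zs) [] ⊞ - t zs)) (≡.sym (cast-is-id ≡.refl ys)) ⟩
    - φ (y G.∙ G.ε ∷ ys) [] ⊞ - (- φ (G.ε G.∙ y ∷ cast ≡.refl ys) [] ⊞ - t (cast ≡.refl ys)) ∎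
    where
    u = φ (G.ε G.∙ y ∷ ys) []
    t : V r → Carrier
    t zs = T C r (λ zs → φ (G.ε ∷ zs) []) (y ∷ zs)
  T-E (suc s) r φ φ-cong (y ∷ y′ ∷ ys) = begin
    - φ ((y G.∙ y′) G.∙ p ∷ ds) (y G.∙ y′ ∷ ts) ⊞ - T C (s + r) (E s ψ) (y′ ∷ ys)
      ≈⟨ +-cong (-‿cong (φ-cong (G.assoc y y′ p ∷ G.≋-refl)))
                -- `ψ` moves `y` into the block, so that the block shrinks to length `s` and the
                -- induction hypothesis applies.
                (-‿cong (T-E s r ψ (λ { (e ∷ es) → φ-cong (G.∙-cong G.refl e ∷ es) }) (y′ ∷ ys))) ⟩
    - φ (y G.∙ (y′ G.∙ p) ∷ ds) (y G.∙ y′ ∷ ts) ⊞ - (E (suc s) (T₂ ψ) (y′ ∷ ys) ⊞ sgn (suc s) (E s (T₁ ψ) xs))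
      ≈⟨ trans (+-congˡ (sym (-‿+-comm _ _))) (sym (+-assoc _ _ _)) ⟩
    (- φ (y G.∙ (y′ G.∙ p) ∷ ds) (y G.∙ y′ ∷ ts) ⊞ - E (suc s) (T₂ ψ) (y′ ∷ ys)) ⊞ - sgn (suc s) (E s (T₁ ψ) xs)
      ≈⟨ +-congˡ (-‿cong (sgn.φ-cong (suc s) (T-merge r (λ zs → φ zs (y ∷ take s xs)) φ-cong y (∏ (take s xs) ∷ drop s xs)))) ⟩
    E (suc (suc s)) (T₂ φ) (y ∷ y′ ∷ ys) ⊞
      sgn (suc (suc s)) (E (suc s) (T₁ φ) (cast (≡.sym (ℕ.+-suc (suc s) r)) (y ∷ y′ ∷ ys))) ∎
    where
    ts = take s ys
    ds = drop s ys
    p = ∏ ts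
    xs : V (s + suc r)
    xs = cast (≡.sym (ℕ.+-suc s r)) (y′ ∷ ys)
    ψ : V (suc r) → V s → Carrier
    ψ zs ws = φ (merge fzero (y ∷ zs)) (y ∷ ws)

  -- (x₁,…,xᵣ₊ₛ) ↦ ψ (x₁⋯xₛ,xₛ₊₁,…,xᵣ₊ₛ) (x₁,…,xₛ)
  contract : ∀ r s → (V (suc r) → V s → Carrier) → V (r + s) → Carrier
  contract r s ψ xs = E s ψ (cast (ℕ.+-comm r s) xs)

  T-contract : ∀ r s (ψ : V (suc r) → V s → Carrier) →
               (∀ {zs zs′ ws} → zs ≋ zs′ → ψ zs ws ≈ ψ zs′ ws) → ∀ xs →
               T C (r + s) (contract r s ψ) xs ≈
               contract r (suc s) (T₂ ψ) (cast (≡.sym (ℕ.+-suc r s)) xs) ⊞ sgn (suc s) (contract (suc r) s (T₁ ψ) xs)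
  T-contract r s ψ ψ-cong xs = begin
    T C (r + s) (contract r s ψ) xs
      ≈⟨ T-cast (ℕ.+-comm r s) (E s ψ) xs ⟩
    T C (s + r) (E s ψ) (cast (cong suc (ℕ.+-comm r s)) xs)
      ≈⟨ T-E s r ψ ψ-cong (cast (cong suc (ℕ.+-comm r s)) xs) ⟩
    E (suc s) (T₂ ψ) (cast (cong suc (ℕ.+-comm r s)) xs) ⊞
      sgn (suc s) (E s (T₁ ψ) (cast (≡.sym (ℕ.+-suc s r)) (cast (cong suc (ℕ.+-comm r s)) xs)))
      ≡⟨ ≡.cong₂ (λ ys zs → E (suc s) (T₂ ψ) ys ⊞ sgn (suc s) (E s (T₁ ψ) zs))
           (≡.sym (cast-trans (≡.sym (ℕ.+-suc r s)) (ℕ.+-comm r (suc s)) xs))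
           (cast-trans (cong suc (ℕ.+-comm r s)) (≡.sym (ℕ.+-suc s r)) xs) ⟩
    contract r (suc s) (T₂ ψ) (cast (≡.sym (ℕ.+-suc r s)) xs) ⊞ sgn (suc s) (contract (suc r) s (T₁ ψ) xs) ∎

  contract-suc : ∀ r s (ψ : V (suc r) → V (suc s) → Carrier) y ys →
                 contract r (suc s) ψ (cast (≡.sym (ℕ.+-suc r s)) (y ∷ ys)) ≡
                 contract r s (λ zs ws → ψ (merge fzero (y ∷ zs)) (y ∷ ws)) ys
  contract-suc r s ψ y ys = cong (E (suc s) ψ) (cast-trans (≡.sym (ℕ.+-suc r s)) (ℕ.+-comm r (suc s)) (y ∷ ys))

  -- For the kernel of f and h and a = 1, this is the sum over 0 ≤ i ≤ r of
  -- (-1)^{i(s+1)} f(x₁,…,xᵢ,xᵢ₊₁⋯xᵢ₊ₛ,xᵢ₊ₛ₊₁,…,xᵣ₊ₛ) ⊗ x₁⋯xᵢ h(xᵢ₊₁,…,xᵢ₊ₛ) .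
  K : ∀ {s} → G.Carrier → ∀ r → Kernel (suc r) s → V (r + s) → Carrier
  K {s} a zero    φ xs       = contract zero s (φ a) xs
  K {s} a (suc r) φ (y ∷ ys) =
    contract (suc r) s (φ a) (y ∷ ys) ⊞ sgn (suc s) (K (a G.∙ y) r (λ b zs → φ b (y ∷ zs)) ys)

  -- The relation R allows the accumulated products to be reassociated or
  -- multiplied from the left.
  K-map : ∀ {θ} → Additive abelianGroup abelianGroup θ →
          ∀ {ℓ′} (R : G.Carrier → G.Carrier → Set ℓ′) → (∀ {b b′} y → R b b′ → R (b G.∙ y) (b′ G.∙ y)) →
          ∀ r {s} {φ ψ : Kernel (suc r) s} →
          (∀ {b b′} zs ws → R b b′ → θ (φ b zs ws) ≈ ψ b′ zs ws) →
          ∀ {a a′} → R a a′ → ∀ xs → θ (K a r φ xs) ≈ K a′ r ψ xs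
  K-map θ R R-∙ zero    p e xs       = p _ _ e
  K-map θ R R-∙ (suc r) {s} p e (y ∷ ys) = trans (Additive.φ-+ θ _ _) (+-cong (p _ _ e)
    (trans (Additive.φ-[-1]^ θ (suc s) _)
      (sgn.φ-cong (suc s) (K-map θ R R-∙ r (λ zs → p (y ∷ zs)) (R-∙ y e) ys))))

  id-additive : Additive abelianGroup abelianGroup (λ x → x)
  id-additive = [-1]^-additive abelianGroup 0

  K-cong : ∀ {a} r {s} (φ ψ : Kernel (suc r) s) → (∀ b zs ws → φ b zs ws ≈ ψ b zs ws) →
           ∀ xs → K a r φ xs ≈ K a r ψ xs
  K-cong r φ ψ p = K-map id-additive _≡_ (λ y → cong (G._∙ y)) r (λ { zs ws ≡.refl → p _ zs ws }) ≡.refl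

  K-congˡ : ∀ {a b} r {s} {φ : Kernel (suc r) s} → Congruent φ → a G.≈ b → ∀ xs → K a r φ xs ≈ K b r φ xs
  K-congˡ r φ-cong =
    K-map id-additive G._≈_ (λ y e → G.∙-cong e G.refl) r (λ zs ws e → φ-cong e G.≋-refl G.≋-refl)

  K-‿ : ∀ {a} r {s} (φ : Kernel (suc r) s) xs → K a r (λ b zs ws → - φ b zs ws) xs ≈ - K a r φ xs
  K-‿ r φ xs = sym (K-map (⁻¹-additive abelianGroup) _≡_ (λ y → cong (G._∙ y)) r (λ { zs ws ≡.refl → refl }) ≡.refl xs)

  K-+ : ∀ {a} r {s} (φ ψ : Kernel (suc r) s) xs →
        K a r (λ b zs ws → φ b zs ws ⊞ ψ b zs ws) xs ≈ K a r φ xs ⊞ K a r ψ xs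
  K-+ zero    φ ψ xs       = refl
  K-+ (suc r) {s} φ ψ (y ∷ ys) = trans (+-congˡ (trans (sgn.φ-cong (suc s) (K-+ r _ _ ys)) (sgn.φ-+ (suc s) _ _)))
                                       (interchange _ _ _ _)

  cast-cong[] : ∀ i {m n} .(eq : m ≡ n) {xs ys : V m} → xs ≋[ i ] ys → cast eq xs ≋[ i ] cast eq ys
  cast-cong[] i {n = zero}  eq []       = []
  cast-cong[] i {n = suc _} eq (p ∷ ps) = p ∷ cast-cong[] i _ ps

  contract-cong[] : ∀ i r s {φ ψ : V (suc r) → V s → Carrier} →
                    (∀ {zs zs′ ws ws′} → zs ≋[ i ] zs′ → ws ≋[ i ] ws′ → φ zs ws ≈ ψ zs′ ws′) →
                    ∀ {xs ys} → xs ≋[ i ] ys → contract r s φ xs ≈ contract r s ψ ys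
  contract-cong[] i r s p ps = p (G.∏-cong[] i ts ∷ G.drop-cong[] i s qs) ts
    where
    qs = cast-cong[] i (ℕ.+-comm r s) ps
    ts = G.take-cong[] i s qs

  -- Two kernels are compared because the recursion of `K` stores the leading variable in the
  -- kernel, and the two arguments may differ there.
  K-cong[] : ∀ i r {s} {φ ψ : Kernel (suc r) s} →
             (∀ {a b zs zs′ ws ws′} → a G.≈[ i ] b → zs ≋[ i ] zs′ → ws ≋[ i ] ws′ → φ a zs ws ≈ ψ b zs′ ws′) →
             ∀ {a b xs ys} → a G.≈[ i ] b → xs ≋[ i ] ys → K a r φ xs ≈ K b r ψ ys
  K-cong[] i zero    {s} p e ps       = contract-cong[] i zero s (p e) ps
  K-cong[] i (suc r) {s} p e (q ∷ qs) = +-cong (contract-cong[] i (suc r) s (p e) (q ∷ qs))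
    (sgn.φ-cong (suc s) (K-cong[] i r (λ e′ es → p e′ (q ∷ es)) (G.∙-cong[] i e q) qs))

  -- The homotopy formula for kernels.

  ∪ : ∀ {r s} → G.Carrier → Kernel r s → V (r + s) → Carrier
  ∪ {r} a φ xs = φ (a G.∙ ∏ (take r xs)) (take r xs) (drop r xs)

  -- Turns the kernel of f and h into that of f and d h.
  δ₂ : ∀ {r s} → Kernel r s → Kernel r (suc s)
  δ₂ φ a zs ws = φ (a G.∙ head ws) zs (tail ws) ⊞ T₂ (φ a) zs ws

  take-cast : ∀ {s} .(eq : s ≡ s + 0) (xs : V s) → take s (cast eq xs) ≡ xs
  take-cast eq []       = ≡.refl
  take-cast eq (x ∷ xs) = cong (x ∷_) (take-cast _ xs)

  -- Induction on `r`, splitting `K` into the summand `i = 0` and the rest. The head term of `δ₂` in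
  -- one summand multiplies a variable into the block product; so does, in the next summand of the
  -- `T₁` part, the merge of the preceding variable with the block product. These have opposite
  -- signs and cancel. The last term of `T₁` in the last summand has no such partner: it gives
  -- `∪ a φ`.
  T-K : ∀ a r {s} (φ : Kernel (suc r) s) → Congruent φ → ∀ xs →
        T C (r + s) (K a r φ) xs ≈
        (K a r (δ₂ φ) (cast (≡.sym (ℕ.+-suc r s)) xs) ⊞ sgn (suc s) (K a (suc r) (λ b → T₁ (φ b)) xs))
          ⊞ - sgn (r * s) (∪ a φ xs)
  T-K a zero {s} φ φ-cong (y ∷ ys) = begin
    T C s (contract 0 s (φ a)) (y ∷ ys)
      ≈⟨ T-contract 0 s (φ a) (λ e → φ-cong G.refl e G.≋-refl) (y ∷ ys) ⟩
    e₁ ⊞ sgn (suc s) e₂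
      ≈⟨ homotopy-base ([-1]^-invol abelianGroup (suc s)) e₁ e₂ x c′ ⟩
    ((x ⊞ e₁) ⊞ sgn (suc s) (e₂ ⊞ sgn (suc s) (- x ⊞ - - c′))) ⊞ - c′
      ≈⟨ +-cong (+-cong (+-congʳ (reflexive (≡.sym (contract-suc 0 s (λ zs ws → φ (a G.∙ head ws) zs (tail ws)) y ys))))
                        (sgn.φ-cong (suc s) (+-congˡ (sgn.φ-cong (suc s)
                          (K-cong 0 (λ b zs ws → - φ b (merge fzero (y ∷ zs)) ws ⊞ - - φ b (y ∷ []) ws)
                             (λ b zs → T₁ (φ b) (y ∷ zs))
                             (λ { b (z ∷ []) ws → refl }) ys)))))
                (-‿cong (trans (reflexive (cong (φ (a G.∙ y) (y ∷ [])) (take-cast _ ys)))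
                               (φ-cong (G.∙-cong G.refl (G.sym (G.identityʳ y))) G.≋-refl G.≋-refl))) ⟩
    (K a 0 (δ₂ φ) (cast (≡.sym (ℕ.+-suc 0 s)) (y ∷ ys)) ⊞ sgn (suc s) (K a 1 (λ b → T₁ (φ b)) (y ∷ ys)))
      ⊞ - ∪ a φ (y ∷ ys) ∎
    where
    open SignAlgebra abelianGroup ([-1]^-additive abelianGroup (suc s))
    e₁ = contract 0 (suc s) (T₂ (φ a)) (cast (≡.sym (ℕ.+-suc 0 s)) (y ∷ ys))
    e₂ = contract 1 s (T₁ (φ a)) (y ∷ ys)
    x = contract 0 s (λ zs → φ (a G.∙ y) (merge fzero (y ∷ zs))) ys
    c′ = φ (a G.∙ y) (y ∷ []) (take s (cast (ℕ.+-comm 0 s) ys))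
  T-K a (suc r) {s} φ φ-cong (y ∷ y′ ∷ ys) = begin
    T C (suc (r + s)) (K a (suc r) φ) (y ∷ y′ ∷ ys)
      ≈⟨ T-cong C (suc (r + s)) (K a (suc r) φ) (λ zs → F₁ zs ⊞ F₂ zs) (λ { (_ ∷ _) → refl }) (y ∷ y′ ∷ ys) ⟩
    T C (suc (r + s)) (λ zs → F₁ zs ⊞ F₂ zs) (y ∷ y′ ∷ ys)
      ≈⟨ T-+ C (suc (r + s)) F₁ F₂ (y ∷ y′ ∷ ys) ⟩
    T C (suc (r + s)) F₁ (y ∷ y′ ∷ ys) ⊞ T C (suc (r + s)) F₂ (y ∷ y′ ∷ ys)
      ≈⟨ +-cong (T-contract (suc r) s (φ a) (λ e → φ-cong G.refl e G.≋-refl) (y ∷ y′ ∷ ys))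
                (+-congˡ (-‿cong (trans (T-map C C ([-1]^-additive abelianGroup (suc s)) (r + s) _ (y′ ∷ ys))
                  (sgn.φ-cong (suc s) (T-K (a G.∙ y) r φ-y φ-y-cong (y′ ∷ ys)))))) ⟩
    (e₁ ⊞ S e₂) ⊞ (- S k₁ ⊞ - S ((k₂ ⊞ S k₃) ⊞ - c′))
      ≈⟨ homotopy-step ([-1]^-invol abelianGroup (suc s)) e₁ e₂ k₁ k₂ k₃ x c′ ⟩
    (((x ⊞ e₁) ⊞ - S k₂) ⊞ S (e₂ ⊞ S (- (x ⊞ S k₁) ⊞ - k₃))) ⊞ S c′
      ≈⟨ +-cong (+-cong (+-congʳ (+-congʳ (reflexive (≡.sym (contract-suc (suc r) s (λ zs ws → φ (a G.∙ head ws) zs (tail ws)) y (y′ ∷ ys))))))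
                        (sgn.φ-cong (suc s) (+-congˡ (sgn.φ-cong (suc s) inner))))
                -- `S` is `(-1)^(s+1)`: one sign stands outside, and the other `s` add to `r * s` to
                -- make `suc r * s`.
                (-‿cong (trans (sgn.φ-cong s (sgn.φ-cong (r * s)
                                 (φ-cong (G.assoc a y _) G.≋-refl G.≋-refl)))
                               (sym ([-1]^-+ abelianGroup s (r * s) _)))) ⟩
    (K a (suc r) (δ₂ φ) (cast (≡.sym (ℕ.+-suc (suc r) s)) (y ∷ y′ ∷ ys))
      ⊞ S (K a (suc (suc r)) (λ b → T₁ (φ b)) (y ∷ y′ ∷ ys)))
      ⊞ - sgn (suc r * s) (∪ a φ (y ∷ y′ ∷ ys)) ∎
    where
    open SignAlgebra abelianGroup ([-1]^-additive abelianGroup (suc s))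
    S = sgn (suc s)
    F₁ F₂ : V (suc (r + s)) → Carrier
    F₁ = contract (suc r) s (φ a)
    F₂ zs = S (K (a G.∙ head zs) r (λ b ws → φ b (head zs ∷ ws)) (tail zs))
    φ-y : Kernel (suc r) s
    φ-y b zs = φ b (y ∷ zs)
    φ-y-cong : Congruent φ-y
    φ-y-cong e es = φ-cong e (G.refl ∷ es)
    e₁ = contract (suc r) (suc s) (T₂ (φ a)) (cast (≡.sym (ℕ.+-suc (suc r) s)) (y ∷ y′ ∷ ys))
    e₂ = contract (suc (suc r)) s (T₁ (φ a)) (y ∷ y′ ∷ ys)
    k₁ = K (a G.∙ (y G.∙ y′)) r (λ b zs → φ b (y G.∙ y′ ∷ zs)) ys
    k₂ = K (a G.∙ y) r (δ₂ φ-y) (cast (≡.sym (ℕ.+-suc r s)) (y′ ∷ ys))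
    k₃ = K (a G.∙ y) (suc r) (λ b → T₁ (φ-y b)) (y′ ∷ ys)
    x = contract (suc r) s (λ zs → φ (a G.∙ y) (merge fzero (y ∷ zs))) (y′ ∷ ys)
    c′ = sgn (r * s) (∪ (a G.∙ y) φ-y (y′ ∷ ys))
    M : Kernel (suc (suc r)) s
    M b zs = φ b (merge fzero (y ∷ zs))
    -- These are the summands `i ≥ 1` of `K a (suc (suc r))` for `T₁`. Here `T₁` splits into the
    -- merge of `y` with the next variable, which yields `x` and `k₁`, and the terms that leave `y`
    -- alone, which yield `k₃`.
    inner : - (x ⊞ S k₁) ⊞ - k₃ ≈ K (a G.∙ y) (suc r) (λ b zs → T₁ (φ b) (y ∷ zs)) (y′ ∷ ys)
    inner = sym (begin
      K (a G.∙ y) (suc r) (λ b zs → T₁ (φ b) (y ∷ zs)) (y′ ∷ ys)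
        ≈⟨ K-cong (suc r) (λ b zs → T₁ (φ b) (y ∷ zs)) (λ b zs ws → - M b zs ws ⊞ - T₁ (φ-y b) zs ws)
             (λ { b (z ∷ zs) ws → refl }) (y′ ∷ ys) ⟩
      K (a G.∙ y) (suc r) (λ b zs ws → - M b zs ws ⊞ - T₁ (φ-y b) zs ws) (y′ ∷ ys)
        ≈⟨ K-+ (suc r) (λ b zs ws → - M b zs ws) (λ b zs ws → - T₁ (φ-y b) zs ws) (y′ ∷ ys) ⟩
      K (a G.∙ y) (suc r) (λ b zs ws → - M b zs ws) (y′ ∷ ys)
        ⊞ K (a G.∙ y) (suc r) (λ b zs ws → - T₁ (φ-y b) zs ws) (y′ ∷ ys)
        ≈⟨ +-cong (K-‿ (suc r) M (y′ ∷ ys)) (K-‿ (suc r) (λ b → T₁ (φ-y b)) (y′ ∷ ys)) ⟩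
      - K (a G.∙ y) (suc r) M (y′ ∷ ys) ⊞ - k₃
        ≈⟨ +-congʳ (-‿cong (+-congˡ (sgn.φ-cong (suc s)
             (K-congˡ r (λ e es → φ-cong e (G.refl ∷ es)) (G.assoc a y y′) ys)))) ⟩
      - (x ⊞ S k₁) ⊞ - k₃ ∎)

-- Cup-one products of cochains.

module _ {g} {G : ProfiniteGroup g} {c₁ ℓ₁ c₂ ℓ₂ c₃ ℓ₃} {A : DiscreteModule G c₁ ℓ₁} {B : DiscreteModule G c₂ ℓ₂}
         {C : DiscreteModule G c₃ ℓ₃} (β : Bilinear A B C) where
  private
    module G = ProfiniteGroup G
    module A = DiscreteModule A
    module B = DiscreteModule B
    module C = DiscreteModule C
  open Bilinear β
  open Cochain
  open _≈ᶜ_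
  open Kernels C
  open SetoidReasoning C.setoid

  kernel : ∀ {r s} → (V r → A.Carrier) → (V s → B.Carrier) → Kernel r s
  kernel f h a zs ws = f zs ⊗ (a B.· h ws)

  kernel-congruent : ∀ {r s} (f : Cochain A r) (h : Cochain B s) → Congruent (kernel (fun f) (fun h))
  kernel-congruent f h p q e =
    ⊗-cong (fun-cong f q) (B.trans (B.·-congʳ _ p) (B.·-congˡ _ (fun-cong h e)))

  -- Treats the accumulated product as one more variable, so that a modulus of continuity is joint
  -- in it and in the arguments of `h`.
  act : ∀ {s} → Cochain B s → V (suc s) → B.Carrier
  act h ws = head ws B.· fun h (tail ws)

  act-continuous : ∀ {s} (h : Cochain B s) → G.Continuous B.setoid (act h)
  act-continuous h = ·-cochain-continuous B head (λ ws → fun h (tail ws)) (λ { i (p ∷ _) → p })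
    (pullback-continuous {G = G} B.setoid tail (λ { i (_ ∷ ps) → ps }) (continuous h))

  abstract
    -- By uniform continuity of  act h  one index serves all the accumulated products.
    cup₁-continuous : ∀ {r s} (f : Cochain A (suc r)) (h : Cochain B s) →
                      G.Continuous C.setoid (K G.ε r (kernel (fun f) (fun h)))
    cup₁-continuous {r} f h xs
      with G.directed≋ (G.modulus A.setoid (fun f) (continuous f)) (G.modulus B.setoid (act h) (act-continuous h))
    ... | k , w = k , λ ys ps → K-cong[] k r
      (λ p q e → ⊗-cong (G.uniform A.setoid (fun f) (continuous f) (proj₁ (w q)))
                        (G.uniform B.setoid (act h) (act-continuous h) (proj₂ (w (p ∷ e)))))
      (G.Q.refl k) ps

  cup₁ : ∀ {r s} → Cochain A (suc r) → Cochain B s → Cochain C (r + s)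
  cup₁ {r} f h = mkCochain (K G.ε r (kernel (fun f) (fun h))) (cup₁-continuous f h)

  cup₁-additiveˡ : ∀ {r s} (h : Cochain B s) → Additive (C^ (suc r) A) (C^ (r + s) C) (λ f → cup₁ f h)
  cup₁-additiveˡ {r} h = record
    { φ-cong = λ {f} {f₁} p → pointwise (K-cong r (kernel (fun f) (fun h)) (kernel (fun f₁) (fun h))
                 (λ b zs ws → ⊗-cong (at p zs) B.refl))
    ; φ-+    = λ f f₁ → pointwise λ xs → C.trans
                 (K-cong r (kernel (fun (f +ᶜ f₁)) (fun h))
                   (λ b zs ws → kernel (fun f) (fun h) b zs ws C.+ kernel (fun f₁) (fun h) b zs ws)
                   (λ b zs ws → ⊗-+ˡ _ _ _) xs)
                 (K-+ r (kernel (fun f) (fun h)) (kernel (fun f₁) (fun h)) xs) }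

  cup₁-additiveʳ : ∀ {r s} (f : Cochain A (suc r)) → Additive (C^ s B) (C^ (r + s) C) (cup₁ f)
  cup₁-additiveʳ {r} f = record
    { φ-cong = λ {h} {h₁} p → pointwise (K-cong r (kernel (fun f) (fun h)) (kernel (fun f) (fun h₁))
                 (λ b zs ws → ⊗-cong A.refl (B.·-congˡ b (at p ws))))
    ; φ-+    = λ h h₁ → pointwise λ xs → C.trans
                 (K-cong r (kernel (fun f) (fun (h +ᶜ h₁)))
                   (λ b zs ws → kernel (fun f) (fun h) b zs ws C.+ kernel (fun f) (fun h₁) b zs ws)
                   (λ b zs ws → C.trans (⊗-cong A.refl (B.·-distrib-+ b _ _)) (⊗-+ʳ _ _ _)) xs)
                 (K-+ r (kernel (fun f) (fun h)) (kernel (fun f) (fun h₁)) xs) }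

  δ₂-kernel : ∀ {r s} (f : V r → A.Carrier) (h : V s → B.Carrier) a zs ws →
              δ₂ (kernel f h) a zs ws C.≈ kernel f (d-fun B s h) a zs ws
  δ₂-kernel {s = s} f h a zs (w ∷ ws) = begin
    f zs ⊗ ((a G.∙ w) B.· h ws) C.+ T C s (λ xs → f zs ⊗ (a B.· h xs)) (w ∷ ws)
      ≈⟨ C.+-cong (⊗-cong A.refl (B.·-assoc a w _))
                  (C.trans (T-map B C (additiveʳ (f zs)) s (λ xs → a B.· h xs) (w ∷ ws))
                           (⊗-cong A.refl (T-map B B (·-additive B a) s h (w ∷ ws)))) ⟩
    f zs ⊗ (a B.· w B.· h ws) C.+ f zs ⊗ (a B.· T B s h (w ∷ ws))
      ≈⟨ ⊗-+ʳ _ _ _ ⟨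
    f zs ⊗ (a B.· w B.· h ws B.+ a B.· T B s h (w ∷ ws))
      ≈⟨ ⊗-cong A.refl (B.·-distrib-+ a _ _) ⟨
    f zs ⊗ (a B.· (w B.· h ws B.+ T B s h (w ∷ ws)))
      ≈⟨ ⊗-cong A.refl (B.·-congˡ a (d≈T B s h w ws)) ⟨
    f zs ⊗ (a B.· d-fun B s h (w ∷ ws)) ∎

  d-kernel : ∀ {r s} (f : V r → A.Carrier) (h : V s → B.Carrier) a zs ws →
             kernel (d-fun A r f) h a zs ws C.≈
             kernel (λ ys → head ys A.· f (tail ys)) h a zs ws C.+ T₁ (kernel f h a) zs ws
  d-kernel {r} f h a (z ∷ zs) ws = C.trans (⊗-cong (d≈T A r f z zs) B.refl)
    (C.trans (⊗-+ˡ _ _ _) (C.+-congˡ (C.sym (T-map A C (additiveˡ _) r f (z ∷ zs)))))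

  -- The block of `h` comes first and its product acts on the value of `f`: this is the cup product
  -- in the opposite order.
  flip-contract : ∀ {r s} (e : s + r ≡ r + s) (f : Cochain A r) (h : Cochain B s) xs →
                  contract r s (kernel (λ ys → head ys A.· fun f (tail ys)) (fun h) G.ε) xs C.≈
                  fun (castᶜ C e (cup (flipBilinear β) h f)) xs
  flip-contract e f h xs = C.trans (⊗-cong A.refl (B.·-identity _))
    (C.reflexive (≡.sym (castᶜ-fun C e (cup (flipBilinear β) h f) xs)))

  -- `d` is the action of the first variable plus `T`, and `T-K` computes the latter. The action on
  -- `f ∪₁ h` supplies the summands `i ≥ 1` of the part of `df ∪₁ h` where the head of `df` acts.
  -- The missing summand `i = 0` of that part is `h ∪ f`, by `flip-contract`.
  d-cup₁ : ∀ {r s} (f : Cochain A (suc r)) (h : Cochain B s) →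
           d (cup₁ f h) ≈ᶜ
           (castᶜ C (ℕ.+-suc r s) (cup₁ f (d h)) +ᶜ [-1]^ (C^ (suc (r + s)) C) (suc s) (cup₁ (d f) h))
             +ᶜ ([-1]^ (C^ (suc (r + s)) C) s (castᶜ C (+-comm s (suc r)) (cup (flipBilinear β) h f))
                 +ᶜ -ᶜ [-1]^ (C^ (suc (r + s)) C) (r * s) (cup β f h))
  d-cup₁ {r} {s} f h = pointwise λ { (x ∷ xs) → begin
    d-fun C (r + s) (K G.ε r φ) (x ∷ xs)
      ≈⟨ d≈T C (r + s) (K G.ε r φ) x xs ⟩
    x C.· K G.ε r φ xs C.+ T C (r + s) (K G.ε r φ) (x ∷ xs)
      ≈⟨ C.+-cong (shift x xs) (T-K G.ε r φ (kernel-congruent f h) (x ∷ xs)) ⟩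
    w x xs C.+ ((a x xs C.+ sgn (suc s) (t x xs)) C.+ C.- sgn (r * s) (∪ G.ε φ (x ∷ xs)))
      ≈⟨ coboundary-step ([-1]^-invol C.abelianGroup (suc s)) (w x xs) (a x xs) (t x xs) (v x xs) (sgn s (v x xs)) _
           (C.-‿inverseˡ _) ⟩
    (a x xs C.+ sgn (suc s) ((v x xs C.+ sgn (suc s) (w x xs)) C.+ t x xs))
      C.+ (sgn s (v x xs) C.+ C.- sgn (r * s) (∪ G.ε φ (x ∷ xs)))
      ≈⟨ C.+-cong
           (C.+-cong
             (C.trans (K-cong r (δ₂ φ) (kernel (fun f) (d-fun B s (fun h))) (δ₂-kernel (fun f) (fun h)) _)
                      (C.reflexive (≡.sym (castᶜ-fun C (ℕ.+-suc r s) (cup₁ f (d h)) (x ∷ xs)))))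
             (C.sym (C.trans (Additive.φ-[-1]^ (eval-additive C (x ∷ xs)) (suc s) (cup₁ (d f) h))
                             (sgn.φ-cong (suc s) (unfold-d x xs)))))
           (C.+-cong
             (C.trans (sgn.φ-cong s (flip-contract (+-comm s (suc r)) f h (x ∷ xs)))
                      (C.sym (Additive.φ-[-1]^ (eval-additive C (x ∷ xs)) s
                                (castᶜ C (+-comm s (suc r)) (cup (flipBilinear β) h f)))))
             (C.-‿cong (C.trans
               (sgn.φ-cong (r * s) (⊗-cong A.refl (B.·-congʳ _ (G.identityˡ _))))
               (C.sym (Additive.φ-[-1]^ (eval-additive C (x ∷ xs)) (r * s) (cup β f h)))))) ⟩
    fun ((castᶜ C (ℕ.+-suc r s) (cup₁ f (d h)) +ᶜ [-1]^ (C^ (suc (r + s)) C) (suc s) (cup₁ (d f) h))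
          +ᶜ ([-1]^ (C^ (suc (r + s)) C) s (castᶜ C (+-comm s (suc r)) (cup (flipBilinear β) h f))
              +ᶜ -ᶜ [-1]^ (C^ (suc (r + s)) C) (r * s) (cup β f h))) (x ∷ xs) ∎ }
    where
    open SignAlgebra C.abelianGroup ([-1]^-additive C.abelianGroup (suc s))
    φ = kernel (fun f) (fun h)
    φ₁ : Kernel (suc (suc r)) s
    φ₁ = kernel (λ ys → head ys A.· fun f (tail ys)) (fun h)
    a t v w : G.Carrier → V (r + s) → C.Carrier
    a x xs = K G.ε r (δ₂ φ) (cast (≡.sym (ℕ.+-suc r s)) (x ∷ xs))
    t x xs = K G.ε (suc r) (λ b → T₁ (φ b)) (x ∷ xs)
    v x xs = contract (suc r) s (φ₁ G.ε) (x ∷ xs)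
    w x xs = K (G.ε G.∙ x) r (λ b zs → φ₁ b (x ∷ zs)) xs
    shift : ∀ x xs → x C.· K G.ε r φ xs C.≈ w x xs
    -- `K` extends accumulated products on the right, so a factor `x` on the left persists through
    -- the recursion.
    shift x = K-map (·-additive C x) (λ b b′ → b′ G.≈ x G.∙ b)
      (λ y e → G.trans (G.∙-cong e G.refl) (G.assoc _ _ _)) r
      (λ zs ws e → C.trans (equivariant x _ _)
        (⊗-cong A.refl (B.trans (B.sym (B.·-assoc _ _ _)) (B.·-congʳ _ (G.sym e)))))
      (G.trans (G.identityˡ x) (G.sym (G.identityʳ x)))
    unfold-d : ∀ x xs → K G.ε (suc r) (kernel (d-fun A (suc r) (fun f)) (fun h)) (x ∷ xs) C.≈
                     (v x xs C.+ sgn (suc s) (w x xs)) C.+ t x xs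
    unfold-d x xs = C.trans
      (K-cong (suc r) (kernel (d-fun A (suc r) (fun f)) (fun h)) (λ b zs ws → φ₁ b zs ws C.+ T₁ (φ b) zs ws)
        (d-kernel (fun f) (fun h)) (x ∷ xs))
      (K-+ (suc r) φ₁ (λ b → T₁ (φ b)) (x ∷ xs))

  -- The degenerate case of d-cup₁: f has degree 0 and f ∪₁ h vanishes.
  cup₁-d₀ : ∀ {s} (e : s + 0 ≡ s) (f : Cochain A 0) (h : Cochain B s) →
            cup₁ (d f) h ≈ᶜ castᶜ C e (cup (flipBilinear β) h f) +ᶜ -ᶜ cup β f h
  cup₁-d₀ {s} e f h = pointwise λ xs → begin
    kernel (d-fun A 0 (fun f)) (fun h) G.ε (p xs ∷ ds xs) (ts xs)
      ≈⟨ d-kernel (fun f) (fun h) G.ε (p xs ∷ ds xs) (ts xs) ⟩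
    kernel (λ ys → head ys A.· fun f (tail ys)) (fun h) G.ε (p xs ∷ ds xs) (ts xs)
      C.+ T C 0 (λ zs → kernel (fun f) (fun h) G.ε zs (ts xs)) (p xs ∷ ds xs)
      ≈⟨ C.+-cong (flip-contract e f h xs) (C.trans
           (T₀ (λ zs → kernel (fun f) (fun h) G.ε zs (ts xs)) (p xs) (ds xs))
           (C.-‿cong (C.reflexive (cong (kernel (fun f) (fun h) G.ε []) (take-cast (+-comm 0 s) xs))))) ⟩
    fun (castᶜ C e (cup (flipBilinear β) h f)) xs C.+ C.- kernel (fun f) (fun h) G.ε [] xs ∎
    where
    p : V s → G.Carrier
    ts : V s → V s
    ds : V s → V 0
    ts xs = take s (cast (+-comm 0 s) xs)
    ds xs = drop s (cast (+-comm 0 s) xs)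
    p xs = G.∏ (ts xs)
    T₀ : ∀ (ψ : V 0 → C.Carrier) x xs → T C 0 ψ (x ∷ xs) C.≈ C.- ψ []
    T₀ ψ x [] = C.refl

-- Changes of degree and signs on cochains and cocycles.

module _ {g} {G : ProfiniteGroup g} {c ℓ} (C : DiscreteModule G c ℓ) where

  castᶜ-castᶜ : ∀ {l m n} (p : l ≡ m) (q : m ≡ n) (e : l ≡ n) (f : Cochain C l) →
                castᶜ C q (castᶜ C p f) ≡ castᶜ C e f
  castᶜ-castᶜ ≡.refl ≡.refl e f = cong (λ e → castᶜ C e f) (ℕ.≡-irrelevant ≡.refl e)

  castᶜ-expand : ∀ {m n} (eq : m ≡ n) i j k (a b u x : Cochain C m) →
                 castᶜ C eq ((a +ᶜ [-1]^ (C^ m C) i b) +ᶜ ([-1]^ (C^ m C) j u +ᶜ -ᶜ [-1]^ (C^ m C) k x)) ≡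
                 (castᶜ C eq a +ᶜ [-1]^ (C^ n C) i (castᶜ C eq b))
                   +ᶜ ([-1]^ (C^ n C) j (castᶜ C eq u) +ᶜ -ᶜ [-1]^ (C^ n C) k (castᶜ C eq x))
  castᶜ-expand ≡.refl i j k a b u x = ≡.refl

  cochain-castᶜ : ∀ {m n} (eq : m ≡ n) (z : Cocycle C m) →
                  Cocycle.cochain (subst (λ k → AbelianGroup.Carrier (H^ k C)) eq z) ≡ castᶜ C eq (Cocycle.cochain z)
  cochain-castᶜ ≡.refl z = ≡.refl

  cochain-[-1]^ : ∀ {n} m (z : Cocycle C n) →
                  Cocycle.cochain ([-1]^ (H^ n C) m z) ≡ [-1]^ (C^ n C) m (Cocycle.cochain z)
  cochain-[-1]^ zero    z = ≡.refl
  cochain-[-1]^ (suc m) z = cong -ᶜ_ (cochain-[-1]^ m z)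

-- Commuting a cochain past a cocycle.

module _ {g} {G : ProfiniteGroup g} {c₁ ℓ₁ c₂ ℓ₂ c₃ ℓ₃} {A : DiscreteModule G c₁ ℓ₁} {B : DiscreteModule G c₂ ℓ₂}
         {C : DiscreteModule G c₃ ℓ₃} (β : Bilinear A B C) where

  -- For `r > 0` the expression bounds `(-1)^(s+1) f ∪₁ h`, since the term with `d h` vanishes. For
  -- `r = 0` it is zero outright, by `cup₁-d₀`.
  cup-flip-coboundary : ∀ r {s} (f : Cochain A r) (h : Cochain B (suc s)) → d h ≈ᶜ 0ᶜ →
    IsCoboundary C (suc (r + s))
      (-ᶜ castᶜ C (ℕ.+-suc r s) (cup₁ β (d f) h)
        +ᶜ (castᶜ C (cong suc (+-comm s r)) (cup (flipBilinear β) h f)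
            +ᶜ -ᶜ [-1]^ (C^ (suc (r + s)) C) (r * suc s) (castᶜ C (ℕ.+-suc r s) (cup β f h))))
  cup-flip-coboundary zero {s} f h _ =
    coboundary-resp C (suc s) {f = 0ᶜ} {h = -ᶜ κ +ᶜ difference}
      (boundary-zero (C^ (suc s) C) {k = κ} {e = difference} κ≈)
      (coboundary-0 C (suc s))
    where
    κ difference : Cochain C (suc s)
    κ = cup₁ β (d f) h
    difference = castᶜ C (cong suc (+-comm s 0)) (cup (flipBilinear β) h f) +ᶜ -ᶜ cup β f h
    κ≈ : κ ≈ᶜ difference
    κ≈ = cup₁-d₀ β {s = suc s} (cong suc (+-comm s 0)) f h
  cup-flip-coboundary (suc r) {s} f h dh≈0 = coboundary-resp C n
    -- `d-cup₁` has exponent `r * suc s` on `f ∪ h`, because `f` has degree `suc r`. The extra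
    -- factor `(-1)^(s+1)` raises it to `suc r * suc s`.
    (boundary-dropˡ N s (r * suc s) {a = a} {k = k} {u = u} {x = x} dk a≈0)
    (coboundary-[-1]^ C n (suc s) (castᶜ C (ℕ.+-suc r s) (cup₁ β f h) , AbelianGroup.refl N))
    where
    n = suc (suc r + s)
    N = C^ n C
    N′ = C^ (suc (r + suc s)) C
    open SetoidReasoning (AbelianGroup.setoid N)
    eq = cong suc (ℕ.+-suc r s)
    fh = cup (flipBilinear β) h f
    a k u x : Cochain C n
    a = castᶜ C eq (castᶜ C (ℕ.+-suc r (suc s)) (cup₁ β f (d h)))
    k = castᶜ C eq (cup₁ β (d f) h)
    u = castᶜ C (cong suc (+-comm s (suc r))) fh
    x = castᶜ C eq (cup β f h)
    a≈0 : a ≈ᶜ 0ᶜ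
    a≈0 = φ-≈0 (C^ (suc (r + suc s)) C) N (castᶜ-additive C eq)
      (φ-≈0 (C^ (r + suc (suc s)) C) (C^ (suc (r + suc s)) C) (castᶜ-additive C (ℕ.+-suc r (suc s)))
        (φ-≈0 (C^ (suc (suc s)) B) (C^ (r + suc (suc s)) C) (cup₁-additiveʳ β f) dh≈0))
    dk : d (castᶜ C (ℕ.+-suc r s) (cup₁ β f h)) ≈ᶜ
         (a +ᶜ [-1]^ N (suc (suc s)) k) +ᶜ ([-1]^ N (suc s) u +ᶜ -ᶜ [-1]^ N (r * suc s) x)
    dk = begin
      d (castᶜ C (ℕ.+-suc r s) (cup₁ β f h))
        ≈⟨ castᶜ-d C (ℕ.+-suc r s) (cup₁ β f h) ⟨
      castᶜ C eq (d (cup₁ β f h))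
        ≈⟨ Additive.φ-cong (castᶜ-additive C eq) (d-cup₁ β f h) ⟩
      castᶜ C eq ((castᶜ C (ℕ.+-suc r (suc s)) (cup₁ β f (d h)) +ᶜ [-1]^ N′ (suc (suc s)) (cup₁ β (d f) h))
                  +ᶜ ([-1]^ N′ (suc s) (castᶜ C (+-comm (suc s) (suc r)) fh) +ᶜ -ᶜ [-1]^ N′ (r * suc s) (cup β f h)))
        ≡⟨ castᶜ-expand C eq (suc (suc s)) (suc s) (r * suc s) (castᶜ C (ℕ.+-suc r (suc s)) (cup₁ β f (d h))) (cup₁ β (d f) h)
             (castᶜ C (+-comm (suc s) (suc r)) fh) (cup β f h) ⟩
      (a +ᶜ [-1]^ N (suc (suc s)) k)
        +ᶜ ([-1]^ N (suc s) (castᶜ C eq (castᶜ C (+-comm (suc s) (suc r)) fh)) +ᶜ -ᶜ [-1]^ N (r * suc s) x)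
        ≡⟨ cong (λ v → (a +ᶜ [-1]^ N (suc (suc s)) k) +ᶜ ([-1]^ N (suc s) v +ᶜ -ᶜ [-1]^ N (r * suc s) x))
             (castᶜ-castᶜ C (+-comm (suc s) (suc r)) eq (cong suc (+-comm s (suc r))) fh) ⟩
      (a +ᶜ [-1]^ N (suc (suc s)) k) +ᶜ ([-1]^ N (suc s) u +ᶜ -ᶜ [-1]^ N (r * suc s) x) ∎

-- Symmetry of the augmented cup product.

module _ {g} {G : ProfiniteGroup g} {c ℓ} (T : TateProduct G c ℓ) where
  open TateProduct T hiding (module C)

  -- The kernels already agree pointwise, as `i` commutes with the accumulated products. This
  -- identifies the correction terms of the two homotopies.
  cup₁-coincide : ∀ {r s} (a′ : Cochain A′ (suc r)) (b′ : Cochain B′ s) →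
                  cup₁ A′×B→C a′ (exact-B.i ∗ b′) ≈ᶜ cup₁ A×B′→C (exact-A.i ∗ a′) b′
  cup₁-coincide {r} a′ b′ = pointwise (K-cong r
    (kernel A′×B→C (fun a′) (fun (exact-B.i ∗ b′))) (kernel A×B′→C (fun (exact-A.i ∗ a′)) (fun b′))
    (λ b zs ws → TateProduct.C.trans T
      (A′×B→C.⊗-cong (DiscreteModule.refl A′) (DiscreteModule.sym B (ModuleHom.equivariant exact-B.i _ _)))
      (coincide _ _)))
    where
    open Cochain
    open Kernels C

  module _ {r s : ℕ} (f : Cochain A r) (f′ : Cochain A′ (suc r)) (h : Cochain B s) (h′ : Cochain B′ (suc s))
           (p : exact-A.i ∗ f′ ≈ᶜ d f) (q : exact-B.i ∗ h′ ≈ᶜ d h) where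
    private
      n = suc (r + s)
      module N = AbelianGroup (C^ n C)

      sgn : ℕ → Cochain C n → Cochain C n
      sgn = [-1]^ (C^ n C)

      κ U V W X : Cochain C n
      κ = castᶜ C (ℕ.+-suc r s) (cup₁ A×B′→C (d f) h′)
      U = castᶜ C (cong suc (+-comm s r)) (cup (flipBilinear A×B′→C) h′ f)
      V = castᶜ C (+-comm s (suc r)) (cup (flipBilinear A′×B→C) h f′)
      W = cup A′×B→C f′ h
      X = castᶜ C (ℕ.+-suc r s) (cup A×B′→C f h′)

      κ≈ : castᶜ C (ℕ.+-suc r s) (cup₁ A′×B→C f′ (d h)) ≈ᶜ κ
      κ≈ = Additive.φ-cong (castᶜ-additive C (ℕ.+-suc r s))
        (M.trans (Additive.φ-cong (cup₁-additiveʳ A′×B→C f′) (AbelianGroup.sym (C^ (suc s) B) q))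
          (M.trans (cup₁-coincide f′ h′) (Additive.φ-cong (cup₁-additiveˡ A×B′→C h′) p)))
        where module M = AbelianGroup (C^ (r + suc s) C)

      cup₁-df′≈0 : cup₁ A′×B→C (d f′) h ≈ᶜ 0ᶜ
      cup₁-df′≈0 = φ-≈0 (C^ (suc (suc r)) A′) (C^ n C) (cup₁-additiveˡ A′×B→C {suc r} h)
                     (i∗-closed exact-A f f′ p)

      -- Bounds `f′ ∪₁ h` for the pairing on `A′ × B`; it compares `df ∪ h` with `h ∪ df`.
      coboundary₁ : IsCoboundary C n (κ +ᶜ (sgn s V +ᶜ -ᶜ sgn (r * s) W))
      coboundary₁ = cup₁ A′×B→C f′ h , boundary-dropʳ (C^ n C) (suc s) (d-cup₁ A′×B→C f′ h) κ≈ cup₁-df′≈0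

      -- Splits off the `(-1)^r` that the second summand of `augᶜ` carries.
      signs : ∀ Y → sgn (r * suc s) Y ≈ᶜ sgn (r * s) (sgn r Y)
      signs Y = N.trans
        (N.reflexive (cong (λ m → sgn m Y) (≡.trans (ℕ.*-suc r s) (+-comm r (r * s)))))
        ([-1]^-+ (C^ n C) (r * s) r Y)

      -- Compares `f ∪ dh` with `dh ∪ f` for the pairing on `A × B′`; the correction term `κ` has
      -- the sign opposite to that in `coboundary₁`.
      coboundary₂ : IsCoboundary C n (-ᶜ κ +ᶜ (U +ᶜ -ᶜ sgn (r * s) (sgn r X)))
      coboundary₂ = coboundary-resp C n
        (N.∙-congˡ {x = -ᶜ κ} (N.∙-congˡ {x = U} (N.⁻¹-cong {sgn (r * suc s) X} {sgn (r * s) (sgn r X)} (signs X))))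
        (cup-flip-coboundary A×B′→C r f h′ (i∗-closed exact-B h h′ q))

      Q : Cochain C n
      Q = castᶜ C (cong suc (+-comm s r)) (augᶜ (flipTate T) h h′ f f′)

      Q≈ : Q ≈ᶜ U +ᶜ sgn s V
      Q≈ = begin
        Q
          ≈⟨ K.φ-+ (cup (flipBilinear A×B′→C) h′ f) ([-1]^ (C^ (suc (s + r)) C) s V′) ⟩
        U +ᶜ castᶜ C (cong suc (+-comm s r)) ([-1]^ (C^ (suc (s + r)) C) s V′)
          ≈⟨ N.∙-congˡ {x = U} (K.φ-[-1]^ s V′) ⟩
        U +ᶜ sgn s (castᶜ C (cong suc (+-comm s r)) V′)
          ≡⟨ cong (λ Y → U +ᶜ sgn s Y)
               (castᶜ-castᶜ C (ℕ.+-suc s r) (cong suc (+-comm s r)) (+-comm s (suc r)) (cup (flipBilinear A′×B→C) h f′)) ⟩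
        U +ᶜ sgn s V ∎
        where
        module K = Additive (castᶜ-additive C (cong suc (+-comm s r)))
        open SetoidReasoning N.setoid
        V′ : Cochain C (suc (s + r))
        V′ = castᶜ C (ℕ.+-suc s r) (cup (flipBilinear A′×B→C) h f′)

    augᶜ-flip : augᶜ T f f′ h h′ ~ sgn (r * s) Q
    -- The two coboundaries add up to `Q - (-1)^(rs) P`. Multiplication by `-(-1)^(rs)` turns this
    -- into `P - (-1)^(rs) Q`.
    augᶜ-flip = mk~ (coboundary-resp C n (sign-transpose (C^ n C) (r * s) P Q)
      (coboundary-[-1]^ C n (suc (r * s)) (coboundary-resp C n eq (coboundary-+ C n coboundary₁ coboundary₂))))
      where
      P : Cochain C n
      P = augᶜ T f f′ h h′
      eq : (κ +ᶜ (sgn s V +ᶜ -ᶜ sgn (r * s) W)) +ᶜ (-ᶜ κ +ᶜ (U +ᶜ -ᶜ sgn (r * s) (sgn r X))) ≈ᶜ Q +ᶜ -ᶜ sgn (r * s) P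
      eq = N.trans (homotopies-cancel (C^ n C) (r * s) κ U (sgn s V) W (sgn r X))
                   (N.∙-congʳ {x = -ᶜ sgn (r * s) P} (N.sym Q≈))

proposition4p1 : ∀ {g c ℓ : Level} (G : ProfiniteGroup g) (T : TateProduct G c ℓ) (r s : ℕ)
    (α″ : AbelianGroup.Carrier (H^ r (TateProduct.A″ T)))
    (β″ : AbelianGroup.Carrier (H^ s (TateProduct.B″ T))) →
    AbelianGroup._≈_ (H^ (suc (r + s)) (TateProduct.C T))
    (augCup T α″ β″)
    ([-1]^ (H^ (suc (r + s)) (TateProduct.C T)) (r * s)
    (subst (λ n → AbelianGroup.Carrier (H^ n (TateProduct.C T))) (cong suc (+-comm s r))
    (augCup (flipTate T) β″ α″)))
proposition4p1 G T r s α″ β″ = subst (λ z → Cocycle.cochain (augCup T α″ β″) ~ z)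
  (≡.sym (≡.trans (cochain-[-1]^ C (r * s) z) (cong ([-1]^ (C^ (suc (r + s)) C) (r * s)) (cochain-castᶜ C eq _))))
  (augᶜ-flip T (f x) (∂f x) (f y) (∂f y) (∂f≈df x) (∂f≈df y))
  where
  open TateProduct T using (C; exact-A; exact-B)
  open Choice
  -- `flipTate` only exchanges the two exact sequences, so both augmented products are computed from
  -- these same lifts.
  x = choose exact-A α″
  y = choose exact-B β″
  eq = cong suc (+-comm s r)
  z = subst (λ n → AbelianGroup.Carrier (H^ n C)) eq (augCup (flipTate T) β″ α″)
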